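{- Let $k\ge1$ be an integer, let $\mathcal{P}_k$ be the class of $k$-polymatroids, and let $\mathcal{P}\subseteq\mathcal{P}_k$ be a minor-closed subclass. Then there exists a unique map $U:\mathcal{P}\to\mathbb{Z}[x,y,a,b]$ such that for every $P\in\mathcal{P}$ and every $e\in E(P)$, $$U(P)=\begin{cases}1,&\text{if }P=\emptyset,\\ a^{k-\Delta(e)}x^{\Delta(e)}\,U(P\setminus e)+b^{k-m(e)}y^{m(e)}\,U(P/e),&\text{otherwise,}\end{cases}$$ where $\Delta(e)=r(P)-r(P\setminus e)$ and $m(e)=k-r(e)$. Moreover, for $P=(E,r)\in\mathcal{P}$, $$U(P;x,y,a,b)=a^{k|E|-r(P)}\,b^{r(P)}\,T_k\!\left(P;\frac{x+b}{b},\frac{y+a}{a}\right).$$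
   Context: A polymatroid is a pair $P=(E,r)$ with $E=E(P)$ a finite set and $r:2^E\to\mathbb{Z}$ such that $r(\emptyset)=0$, $r(A)\le r(B)$ whenever $A\subseteq B$, and $r(A)+r(B)\ge r(A\cup B)+r(A\cap B)$ for all $A,B\subseteq E$. It is a $k$-polymatroid if $r(e):=r(\{e\})\le k$ for all $e\in E$. Write $r(P)=r(E)$; $P=\emptyset$ means that the groundset is empty (the condition $U(\emptyset)=1$ is imposed for the empty polymatroid, and the recursion is required for every nonempty $P$ and every $e\in E(P)$). Deletion: $P\setminus A=(E\setminus A,\,r|_{2^{E\setminus A}})$. Contraction: $P/A=(E\setminus A,r_{P/A})$ with $r_{P/A}(X)=r(X\cup A)-r(A)$. Write $P\setminus e$, $P/e$ for $A=\{e\}$. A minor of $P$ is any polymatroid $(P/A)\setminus B$ with $A,B\subseteq E$ disjoint; minor-closed means closed under taking minors. $k$-polymatroid Tutte polynomial: $T_k(P;x,y)=\sum_{A\subseteq E}(x-1)^{r(E)-r(A)}(y-1)^{k|A|-r(A)}$. -}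

module Defs where

open import Algebra.Bundles using (CommutativeRing)
import Algebra.Properties.Ring as RingProperties
import Algebra.Properties.Semiring.Exp as Exp
import Algebra.Solver.Ring.NaturalCoefficients.Default as SemiringSolver
open import Data.Fin.Base using (Fin)
open import Data.Fin.Subset
  using (Subset; inside; outside; _∈_; _⊆_; _∪_; _∩_; _─_; ⁅_⁆; ⊥; Empty)
  renaming (∣_∣ to card)
open import Data.Fin.Subset.Properties
open import Data.Integer.Base as ℤ using (ℤ; +_; ∣_∣)
import Data.Integer.Properties as ℤ
open import Data.Integer.Tactic.RingSolver using (solve-∀)
open import Data.List.Base using (List; []; _∷_; map)
open import Data.Nat.Base as ℕ using (ℕ; zero; suc)
open import Data.Product.Base using (_,_; proj₁)
open import Data.Sum.Base using ([_,_]′)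
open import Data.Vec.Base using ([]; _∷_)
open import Function.Bundles using (Func; _⟨$⟩_)
open import Level using (Level; _⊔_; 0ℓ) renaming (suc to lsuc)
open import Relation.Binary.Bundles using (Setoid)
import Relation.Binary.Construct.On as On
import Relation.Binary.Reasoning.Setoid as SetoidReasoning
open import Relation.Binary.PropositionalEquality as ≡ using (_≡_)
open import Relation.Unary using (Pred)

private
  variable
    c ℓ : Level
    n : ℕ

-- A polynomial is the list of its coefficients, constant term first.  Lists
-- differing by trailing zeros are identified by _≋_.

module Polynomial (R : CommutativeRing c ℓ) where
  private module R = CommutativeRing R
  open R using (Carrier; _≈_; 0#; 1#)
  open RingProperties R.ring using (-0#≈0#)

  infix  4 _≋_
  infixl 6 _⊕_
  infixl 7 _⊛_

  coeff : List Carrier → ℕ → Carrier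
  coeff []      _       = 0#
  coeff (s ∷ p) zero    = s
  coeff (s ∷ p) (suc i) = coeff p i

  record _≋_ (p q : List Carrier) : Set ℓ where
    constructor coeffwise
    field at : ∀ i → coeff p i ≈ coeff q i
  open _≋_ public

  _⊕_ : List Carrier → List Carrier → List Carrier
  []      ⊕ q       = q
  (s ∷ p) ⊕ []      = s ∷ p
  (s ∷ p) ⊕ (t ∷ q) = (s R.+ t) ∷ (p ⊕ q)

  ⊖_ : List Carrier → List Carrier
  ⊖_ = map (λ s → R.- s)

  scale : Carrier → List Carrier → List Carrier
  scale s = map (s R.*_)

  _⊛_ : List Carrier → List Carrier → List Carrier
  []      ⊛ q = []
  (s ∷ p) ⊛ q = scale s q ⊕ (0# ∷ p ⊛ q)

  constant : Carrier → List Carrier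
  constant s = s ∷ []

  X : List Carrier
  X = 0# ∷ 1# ∷ []

  coeff-⊕ : ∀ p q i → coeff (p ⊕ q) i ≈ coeff p i R.+ coeff q i
  coeff-⊕ []      q       i       = R.sym (R.+-identityˡ _)
  coeff-⊕ (s ∷ p) []      i       = R.sym (R.+-identityʳ _)
  coeff-⊕ (s ∷ p) (t ∷ q) zero    = R.refl
  coeff-⊕ (s ∷ p) (t ∷ q) (suc i) = coeff-⊕ p q i

  coeff-⊖ : ∀ p i → coeff (⊖ p) i ≈ R.- coeff p i
  coeff-⊖ []      i       = R.sym -0#≈0#
  coeff-⊖ (s ∷ p) zero    = R.refl
  coeff-⊖ (s ∷ p) (suc i) = coeff-⊖ p i

  coeff-scale : ∀ s p i → coeff (scale s p) i ≈ s R.* coeff p i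
  coeff-scale s []      i       = R.sym (R.zeroʳ s)
  coeff-scale s (t ∷ p) zero    = R.refl
  coeff-scale s (t ∷ p) (suc i) = coeff-scale s p i

  private
    ≋-setoid : Setoid c ℓ
    ≋-setoid = record
      { Carrier       = List Carrier
      ; _≈_           = _≋_
      ; isEquivalence = record
        { refl  = coeffwise λ i → R.refl
        ; sym   = λ e → coeffwise λ i → R.sym (at e i)
        ; trans = λ e f → coeffwise λ i → R.trans (at e i) (at f i)
        }
      }

    open Setoid ≋-setoid using ()
      renaming (refl to ≋-refl; sym to ≋-sym; trans to ≋-trans)
    open SetoidReasoning ≋-setoid

    ⊕-cong : ∀ {p p′ q q′} → p ≋ p′ → q ≋ q′ → p ⊕ q ≋ p′ ⊕ q′
    ⊕-cong {p} {p′} {q} {q′} e f = coeffwise λ i →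
      R.trans (coeff-⊕ p q i)
        (R.trans (R.+-cong (at e i) (at f i)) (R.sym (coeff-⊕ p′ q′ i)))

    ⊕-comm : ∀ p q → p ⊕ q ≋ q ⊕ p
    ⊕-comm p q = coeffwise λ i →
      R.trans (coeff-⊕ p q i)
        (R.trans (R.+-comm _ _) (R.sym (coeff-⊕ q p i)))

    ⊕-assoc : ∀ p q r → (p ⊕ q) ⊕ r ≋ p ⊕ (q ⊕ r)
    ⊕-assoc p q r = coeffwise λ i →
      R.trans (coeff-⊕ (p ⊕ q) r i)
        (R.trans (R.+-congʳ (coeff-⊕ p q i))
          (R.trans (R.+-assoc _ _ _)
            (R.trans (R.+-congˡ (R.sym (coeff-⊕ q r i)))
              (R.sym (coeff-⊕ p (q ⊕ r) i)))))

    ⊕-identityʳ : ∀ p → p ⊕ [] ≋ p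
    ⊕-identityʳ p = coeffwise λ i →
      R.trans (coeff-⊕ p [] i) (R.+-identityʳ _)

    ⊖-cong : ∀ {p q} → p ≋ q → ⊖ p ≋ ⊖ q
    ⊖-cong {p} {q} e = coeffwise λ i →
      R.trans (coeff-⊖ p i)
        (R.trans (R.-‿cong (at e i)) (R.sym (coeff-⊖ q i)))

    ⊖-inverseˡ : ∀ p → (⊖ p) ⊕ p ≋ []
    ⊖-inverseˡ p = coeffwise λ i →
      R.trans (coeff-⊕ (⊖ p) p i)
        (R.trans (R.+-congʳ (coeff-⊖ p i)) (R.-‿inverseˡ _))

    interchange : ∀ p q r s → (p ⊕ q) ⊕ (r ⊕ s) ≋ (p ⊕ r) ⊕ (q ⊕ s)
    interchange p q r s = begin
      (p ⊕ q) ⊕ (r ⊕ s)  ≈⟨ ⊕-assoc p q (r ⊕ s) ⟩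
      p ⊕ (q ⊕ (r ⊕ s))  ≈⟨ ⊕-cong (≋-refl {p}) (⊕-assoc q r s) ⟨
      p ⊕ ((q ⊕ r) ⊕ s)  ≈⟨ ⊕-cong (≋-refl {p}) (⊕-cong (⊕-comm q r) (≋-refl {s})) ⟩
      p ⊕ ((r ⊕ q) ⊕ s)  ≈⟨ ⊕-cong (≋-refl {p}) (⊕-assoc r q s) ⟩
      p ⊕ (r ⊕ (q ⊕ s))  ≈⟨ ⊕-assoc p r (q ⊕ s) ⟨
      (p ⊕ r) ⊕ (q ⊕ s)  ∎

    ∷-cong : ∀ {s t p q} → s ≈ t → p ≋ q → s ∷ p ≋ t ∷ q
    ∷-cong e f = coeffwise λ where
      zero    → e
      (suc i) → at f i

    0∷[] : 0# ∷ [] ≋ []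
    0∷[] = coeffwise λ where
      zero    → R.refl
      (suc i) → R.refl

    scale-cong : ∀ {s t p q} → s ≈ t → p ≋ q → scale s p ≋ scale t q
    scale-cong {s} {t} {p} {q} e f = coeffwise λ i →
      R.trans (coeff-scale s p i)
        (R.trans (R.*-cong e (at f i)) (R.sym (coeff-scale t q i)))

    scale-⊕ : ∀ s p q → scale s (p ⊕ q) ≋ scale s p ⊕ scale s q
    scale-⊕ s p q = coeffwise λ i →
      R.trans (coeff-scale s (p ⊕ q) i)
        (R.trans (R.*-congˡ (coeff-⊕ p q i))
          (R.trans (R.distribˡ _ _ _)
            (R.trans (R.+-cong (R.sym (coeff-scale s p i)) (R.sym (coeff-scale s q i)))
              (R.sym (coeff-⊕ (scale s p) (scale s q) i)))))

    scale-* : ∀ s t p → scale (s R.* t) p ≋ scale s (scale t p)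
    scale-* s t p = coeffwise λ i →
      R.trans (coeff-scale (s R.* t) p i)
        (R.trans (R.*-assoc _ _ _)
          (R.trans (R.*-congˡ (R.sym (coeff-scale t p i)))
            (R.sym (coeff-scale s (scale t p) i))))

    scale-0∷ : ∀ s p → scale s (0# ∷ p) ≋ 0# ∷ scale s p
    scale-0∷ s p = ∷-cong (R.zeroʳ s) (≋-refl {scale s p})

    scale-1 : ∀ p → scale 1# p ≋ p
    scale-1 p = coeffwise λ i →
      R.trans (coeff-scale 1# p i) (R.*-identityˡ _)

    scale-0 : ∀ p → scale 0# p ≋ []
    scale-0 p = coeffwise λ i →
      R.trans (coeff-scale 0# p i) (R.zeroˡ _)

    0∷-⊕ : ∀ p q → 0# ∷ (p ⊕ q) ≋ (0# ∷ p) ⊕ (0# ∷ q)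
    0∷-⊕ p q = ∷-cong (R.sym (R.+-identityʳ _)) (≋-refl {p ⊕ q})

    0∷-⊛ : ∀ p q → (0# ∷ p) ⊛ q ≋ 0# ∷ p ⊛ q
    0∷-⊛ p q = ⊕-cong (scale-0 q) (≋-refl {0# ∷ p ⊛ q})

    constant-⊛ : ∀ s q → constant s ⊛ q ≋ scale s q
    constant-⊛ s q =
      ≋-trans (⊕-cong (≋-refl {scale s q}) 0∷[]) (⊕-identityʳ (scale s q))

    ⊛-congˡ : ∀ p {q q′} → q ≋ q′ → p ⊛ q ≋ p ⊛ q′
    ⊛-congˡ []      e = ≋-refl
    ⊛-congˡ (s ∷ p) e =
      ⊕-cong (scale-cong R.refl e) (∷-cong R.refl (⊛-congˡ p e))

    ⊛-zeroʳ : ∀ p → p ⊛ [] ≋ []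
    ⊛-zeroʳ []      = ≋-refl
    ⊛-zeroʳ (s ∷ p) = ≋-trans (∷-cong R.refl (⊛-zeroʳ p)) 0∷[]

    ⊛-∷ʳ : ∀ p t q → p ⊛ (t ∷ q) ≋ scale t p ⊕ (0# ∷ p ⊛ q)
    ⊛-∷ʳ []      t q = ≋-sym 0∷[]
    ⊛-∷ʳ (s ∷ p) t q = ∷-cong (R.+-congʳ (R.*-comm s t)) (begin
      scale s q ⊕ p ⊛ (t ∷ q)
        ≈⟨ ⊕-cong (≋-refl {scale s q}) (⊛-∷ʳ p t q) ⟩
      scale s q ⊕ (scale t p ⊕ (0# ∷ p ⊛ q))
        ≈⟨ ⊕-assoc (scale s q) (scale t p) (0# ∷ p ⊛ q) ⟨
      (scale s q ⊕ scale t p) ⊕ (0# ∷ p ⊛ q)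
        ≈⟨ ⊕-cong (⊕-comm (scale s q) (scale t p)) (≋-refl {0# ∷ p ⊛ q}) ⟩
      (scale t p ⊕ scale s q) ⊕ (0# ∷ p ⊛ q)
        ≈⟨ ⊕-assoc (scale t p) (scale s q) (0# ∷ p ⊛ q) ⟩
      scale t p ⊕ (s ∷ p) ⊛ q ∎)

    ⊛-comm : ∀ p q → p ⊛ q ≋ q ⊛ p
    ⊛-comm []      q = ≋-sym (⊛-zeroʳ q)
    ⊛-comm (s ∷ p) q = ≋-trans
      (⊕-cong (≋-refl {scale s q}) (∷-cong R.refl (⊛-comm p q)))
      (≋-sym (⊛-∷ʳ q s p))

    ⊛-cong : ∀ {p p′ q q′} → p ≋ p′ → q ≋ q′ → p ⊛ q ≋ p′ ⊛ q′
    ⊛-cong {p} {p′} {q} {q′} e f = begin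
      p ⊛ q    ≈⟨ ⊛-congˡ p f ⟩
      p ⊛ q′   ≈⟨ ⊛-comm p q′ ⟩
      q′ ⊛ p   ≈⟨ ⊛-congˡ q′ e ⟩
      q′ ⊛ p′  ≈⟨ ⊛-comm q′ p′ ⟩
      p′ ⊛ q′  ∎

    ⊛-distribˡ : ∀ p q r → p ⊛ (q ⊕ r) ≋ p ⊛ q ⊕ p ⊛ r
    ⊛-distribˡ []      q r = ≋-refl
    ⊛-distribˡ (s ∷ p) q r = begin
      scale s (q ⊕ r) ⊕ (0# ∷ p ⊛ (q ⊕ r))
        ≈⟨ ⊕-cong (scale-⊕ s q r) (≋-trans (∷-cong R.refl (⊛-distribˡ p q r))
                                           (0∷-⊕ (p ⊛ q) (p ⊛ r))) ⟩
      (scale s q ⊕ scale s r) ⊕ ((0# ∷ p ⊛ q) ⊕ (0# ∷ p ⊛ r))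
        ≈⟨ interchange (scale s q) (scale s r) (0# ∷ p ⊛ q) (0# ∷ p ⊛ r) ⟩
      (s ∷ p) ⊛ q ⊕ (s ∷ p) ⊛ r ∎

    ⊛-distribʳ : ∀ p q r → (q ⊕ r) ⊛ p ≋ q ⊛ p ⊕ r ⊛ p
    ⊛-distribʳ p q r = begin
      (q ⊕ r) ⊛ p    ≈⟨ ⊛-comm (q ⊕ r) p ⟩
      p ⊛ (q ⊕ r)    ≈⟨ ⊛-distribˡ p q r ⟩
      p ⊛ q ⊕ p ⊛ r  ≈⟨ ⊕-cong (⊛-comm p q) (⊛-comm p r) ⟩
      q ⊛ p ⊕ r ⊛ p  ∎

    scale-⊛ : ∀ s p q → scale s p ⊛ q ≋ scale s (p ⊛ q)
    scale-⊛ s []      q = ≋-refl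
    scale-⊛ s (t ∷ p) q = begin
      scale (s R.* t) q ⊕ (0# ∷ scale s p ⊛ q)
        ≈⟨ ⊕-cong (scale-* s t q) (∷-cong R.refl (scale-⊛ s p q)) ⟩
      scale s (scale t q) ⊕ (0# ∷ scale s (p ⊛ q))
        ≈⟨ ⊕-cong (≋-refl {scale s (scale t q)}) (scale-0∷ s (p ⊛ q)) ⟨
      scale s (scale t q) ⊕ scale s (0# ∷ p ⊛ q)
        ≈⟨ scale-⊕ s (scale t q) (0# ∷ p ⊛ q) ⟨
      scale s ((t ∷ p) ⊛ q) ∎

    ⊛-assoc : ∀ p q r → (p ⊛ q) ⊛ r ≋ p ⊛ (q ⊛ r)
    ⊛-assoc []      q r = ≋-refl
    ⊛-assoc (s ∷ p) q r = begin
      (scale s q ⊕ (0# ∷ p ⊛ q)) ⊛ r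
        ≈⟨ ⊛-distribʳ r (scale s q) (0# ∷ p ⊛ q) ⟩
      scale s q ⊛ r ⊕ (0# ∷ p ⊛ q) ⊛ r
        ≈⟨ ⊕-cong (scale-⊛ s q r) (≋-trans (0∷-⊛ (p ⊛ q) r)
                                           (∷-cong R.refl (⊛-assoc p q r))) ⟩
      (s ∷ p) ⊛ (q ⊛ r) ∎

    ⊛-identityˡ : ∀ p → constant 1# ⊛ p ≋ p
    ⊛-identityˡ p = ≋-trans (constant-⊛ 1# p) (scale-1 p)

  polynomialRing : CommutativeRing c ℓ
  polynomialRing = record
    { Carrier = List Carrier
    ; _≈_     = _≋_
    ; _+_     = _⊕_
    ; _*_     = _⊛_
    ; -_      = ⊖_
    ; 0#      = []
    ; 1#      = constant 1#
    ; isCommutativeRing = record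
      { isRing = record
        { +-isAbelianGroup = record
          { isGroup = record
            { isMonoid = record
              { isSemigroup = record
                { isMagma = record
                  { isEquivalence = Setoid.isEquivalence ≋-setoid
                  ; ∙-cong        = ⊕-cong
                  }
                ; assoc = ⊕-assoc
                }
              ; identity = (λ p → ≋-refl) , ⊕-identityʳ
              }
            ; inverse = ⊖-inverseˡ
                      , λ p → ≋-trans (⊕-comm p (⊖ p)) (⊖-inverseˡ p)
            ; ⁻¹-cong = ⊖-cong
            }
          ; comm = ⊕-comm
          }
        ; *-cong     = ⊛-cong
        ; *-assoc    = ⊛-assoc
        ; *-identity = ⊛-identityˡ
                     , λ p → ≋-trans (⊛-comm p (constant 1#)) (⊛-identityˡ p)
        ; distrib    = ⊛-distribˡ , ⊛-distribʳ
        }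
      ; *-comm = ⊛-comm
      }
    }

  X-cancel : ∀ p q → X ⊛ p ≋ X ⊛ q → p ≋ q
  X-cancel p q e = coeffwise λ i →
    at (≋-trans (≋-sym (X-⊛ p)) (≋-trans e (X-⊛ q))) (suc i)
    where
    X-⊛ : ∀ p → X ⊛ p ≋ 0# ∷ p
    X-⊛ p = ≋-trans (0∷-⊛ (constant 1#) p) (∷-cong R.refl (⊛-identityˡ p))

  constant-cancel : ∀ s → (∀ t u → s R.* t ≈ s R.* u → t ≈ u) →
                    ∀ p q → constant s ⊛ p ≋ constant s ⊛ q → p ≋ q
  constant-cancel s cancel p q e = coeffwise λ i → cancel _ _
    (R.trans (R.sym (coeff-scale s p i))
      (R.trans (at (≋-trans (≋-sym (constant-⊛ s p)) (≋-trans e (constant-⊛ s q))) i)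
        (coeff-scale s q i)))

-- Denominators range over all regular elements (non-zero-divisors), so for an
-- integral domain this is the field of fractions.

module TotalFractions (R : CommutativeRing c ℓ) where
  open CommutativeRing R hiding (zero)
  open RingProperties ring using (-‿distribˡ-*)
  open SetoidReasoning setoid
  open SemiringSolver commutativeSemiring using (solve; _:=_; _:+_; _:*_; con)

  Regular : Carrier → Set (c ⊔ ℓ)
  Regular s = ∀ p q → s * p ≈ s * q → p ≈ q

  infix 5 _/_[_]

  record Fraction : Set (c ⊔ ℓ) where
    constructor _/_[_]
    field
      num     : Carrier
      den     : Carrier
      regular : Regular den
  open Fraction public

  infix 4 _≃_

  record _≃_ (p q : Fraction) : Set ℓ where
    constructor cross
    field eq : num p * den q ≈ num q * den p
  open _≃_ public

  private
    1-regular : Regular 1#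
    1-regular p q e = trans (sym (*-identityˡ _)) (trans e (*-identityˡ _))

    *-regular : ∀ {s t} → Regular s → Regular t → Regular (s * t)
    *-regular rs rt p q e =
      rt _ _ (rs _ _ (trans (sym (*-assoc _ _ _)) (trans e (*-assoc _ _ _))))

  embed : Carrier → Fraction
  embed s = s / 1# [ 1-regular ]

  _+ᶠ_ : Fraction → Fraction → Fraction
  (m / s [ rs ]) +ᶠ (n / t [ rt ]) = (m * t + n * s) / s * t [ *-regular rs rt ]

  _*ᶠ_ : Fraction → Fraction → Fraction
  (m / s [ rs ]) *ᶠ (n / t [ rt ]) = (m * n) / s * t [ *-regular rs rt ]

  -ᶠ_ : Fraction → Fraction
  -ᶠ (m / s [ rs ]) = (- m) / s [ rs ]

  private
    ≃-trans : ∀ {p q r} → p ≃ q → q ≃ r → p ≃ r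
    ≃-trans {k / s [ _ ]} {m / t [ rt ]} {n / u [ _ ]} (cross e) (cross f) =
      cross (rt _ _ (begin
        t * (k * u)  ≈⟨ solve 3 (λ t k u → t :* (k :* u) := k :* t :* u) refl t k u ⟩
        k * t * u    ≈⟨ *-congʳ e ⟩
        m * s * u    ≈⟨ solve 3 (λ m s u → m :* s :* u := m :* u :* s) refl m s u ⟩
        m * u * s    ≈⟨ *-congʳ f ⟩
        n * t * s    ≈⟨ solve 3 (λ n t s → n :* t :* s := t :* (n :* s)) refl n t s ⟩
        t * (n * s)  ∎))

    +ᶠ-cong : ∀ {p p′ q q′} → p ≃ p′ → q ≃ q′ → (p +ᶠ q) ≃ (p′ +ᶠ q′)
    +ᶠ-cong {m / s [ _ ]} {m′ / s′ [ _ ]} {n / t [ _ ]} {n′ / t′ [ _ ]} (cross e) (cross f) =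
      cross (begin
        (m * t + n * s) * (s′ * t′)
          ≈⟨ solve 6 (λ m s n t s′ t′ → (m :* t :+ n :* s) :* (s′ :* t′)
               := m :* s′ :* (t :* t′) :+ n :* t′ :* (s :* s′)) refl m s n t s′ t′ ⟩
        m * s′ * (t * t′) + n * t′ * (s * s′)
          ≈⟨ +-cong (*-congʳ e) (*-congʳ f) ⟩
        m′ * s * (t * t′) + n′ * t * (s * s′)
          ≈⟨ solve 6 (λ m′ s n′ t s′ t′ → m′ :* s :* (t :* t′) :+ n′ :* t :* (s :* s′)
               := (m′ :* t′ :+ n′ :* s′) :* (s :* t)) refl m′ s n′ t s′ t′ ⟩
        (m′ * t′ + n′ * s′) * (s * t) ∎)

    *ᶠ-cong : ∀ {p p′ q q′} → p ≃ p′ → q ≃ q′ → (p *ᶠ q) ≃ (p′ *ᶠ q′)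
    *ᶠ-cong {m / s [ _ ]} {m′ / s′ [ _ ]} {n / t [ _ ]} {n′ / t′ [ _ ]} (cross e) (cross f) =
      cross (begin
        m * n * (s′ * t′)
          ≈⟨ solve 4 (λ m n s′ t′ → m :* n :* (s′ :* t′) := m :* s′ :* (n :* t′)) refl m n s′ t′ ⟩
        m * s′ * (n * t′)
          ≈⟨ *-cong e f ⟩
        m′ * s * (n′ * t)
          ≈⟨ solve 4 (λ m′ s n′ t → m′ :* s :* (n′ :* t) := m′ :* n′ :* (s :* t)) refl m′ s n′ t ⟩
        m′ * n′ * (s * t) ∎)

    -ᶠ-cong : ∀ {p q} → p ≃ q → (-ᶠ p) ≃ (-ᶠ q)
    -ᶠ-cong {m / s [ _ ]} {n / t [ _ ]} (cross e) = cross (begin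
      - m * t    ≈⟨ -‿distribˡ-* m t ⟨
      - (m * t)  ≈⟨ -‿cong e ⟩
      - (n * s)  ≈⟨ -‿distribˡ-* n s ⟩
      - n * s    ∎)

    +ᶠ-comm : ∀ p q → (p +ᶠ q) ≃ (q +ᶠ p)
    +ᶠ-comm (m / s [ _ ]) (n / t [ _ ]) = cross
      (solve 4 (λ m s n t → (m :* t :+ n :* s) :* (t :* s)
        := (n :* s :+ m :* t) :* (s :* t)) refl m s n t)

    +ᶠ-assoc : ∀ p q r → ((p +ᶠ q) +ᶠ r) ≃ (p +ᶠ (q +ᶠ r))
    +ᶠ-assoc (k / s [ _ ]) (m / t [ _ ]) (n / u [ _ ]) = cross
      (solve 6 (λ k s m t n u →
         ((k :* t :+ m :* s) :* u :+ n :* (s :* t)) :* (s :* (t :* u))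
         := (k :* (t :* u) :+ (m :* u :+ n :* t) :* s) :* (s :* t :* u))
        refl k s m t n u)

    +ᶠ-identityˡ : ∀ p → (embed 0# +ᶠ p) ≃ p
    +ᶠ-identityˡ (m / s [ _ ]) = cross
      (solve 2 (λ m s → (con 0 :* s :+ m :* con 1) :* s := m :* (con 1 :* s)) refl m s)

    +ᶠ-inverseˡ : ∀ p → ((-ᶠ p) +ᶠ p) ≃ embed 0#
    +ᶠ-inverseˡ (m / s [ _ ]) = cross (begin
      (- m * s + m * s) * 1#  ≈⟨ *-congʳ (distribʳ s (- m) m) ⟨
      (- m + m) * s * 1#      ≈⟨ *-congʳ (*-congʳ (-‿inverseˡ m)) ⟩
      0# * s * 1#             ≈⟨ solve 1 (λ s → con 0 :* s :* con 1 := con 0 :* (s :* s)) refl s ⟩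
      0# * (s * s)            ∎)

    *ᶠ-comm : ∀ p q → (p *ᶠ q) ≃ (q *ᶠ p)
    *ᶠ-comm (m / s [ _ ]) (n / t [ _ ]) = cross
      (solve 4 (λ m s n t → m :* n :* (t :* s) := n :* m :* (s :* t)) refl m s n t)

    *ᶠ-assoc : ∀ p q r → ((p *ᶠ q) *ᶠ r) ≃ (p *ᶠ (q *ᶠ r))
    *ᶠ-assoc (k / s [ _ ]) (m / t [ _ ]) (n / u [ _ ]) = cross
      (solve 6 (λ k s m t n u → k :* m :* n :* (s :* (t :* u))
        := k :* (m :* n) :* (s :* t :* u)) refl k s m t n u)

    *ᶠ-identityˡ : ∀ p → (embed 1# *ᶠ p) ≃ p
    *ᶠ-identityˡ (m / s [ _ ]) = cross
      (solve 2 (λ m s → con 1 :* m :* s := m :* (con 1 :* s)) refl m s)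

    *ᶠ-distribˡ : ∀ p q r → (p *ᶠ (q +ᶠ r)) ≃ ((p *ᶠ q) +ᶠ (p *ᶠ r))
    *ᶠ-distribˡ (k / s [ _ ]) (m / t [ _ ]) (n / u [ _ ]) = cross
      (solve 6 (λ k s m t n u →
         k :* (m :* u :+ n :* t) :* (s :* t :* (s :* u))
         := (k :* m :* (s :* u) :+ k :* n :* (s :* t)) :* (s :* (t :* u)))
        refl k s m t n u)

    *ᶠ-distribʳ : ∀ p q r → ((q +ᶠ r) *ᶠ p) ≃ ((q *ᶠ p) +ᶠ (r *ᶠ p))
    *ᶠ-distribʳ p q r =
      ≃-trans (*ᶠ-comm (q +ᶠ r) p)
        (≃-trans (*ᶠ-distribˡ p q r) (+ᶠ-cong (*ᶠ-comm p q) (*ᶠ-comm p r)))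

  fractionRing : CommutativeRing (c ⊔ ℓ) ℓ
  fractionRing = record
    { Carrier = Fraction
    ; _≈_     = _≃_
    ; _+_     = _+ᶠ_
    ; _*_     = _*ᶠ_
    ; -_      = -ᶠ_
    ; 0#      = embed 0#
    ; 1#      = embed 1#
    ; isCommutativeRing = record
      { isRing = record
        { +-isAbelianGroup = record
          { isGroup = record
            { isMonoid = record
              { isSemigroup = record
                { isMagma = record
                  { isEquivalence = record
                    { refl  = cross refl
                    ; sym   = λ e → cross (sym (eq e))
                    ; trans = ≃-trans
                    }
                  ; ∙-cong = +ᶠ-cong
                  }
                ; assoc = +ᶠ-assoc
                }
              ; identity = +ᶠ-identityˡ
                         , λ p → ≃-trans (+ᶠ-comm p (embed 0#)) (+ᶠ-identityˡ p)
              }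
            ; inverse = +ᶠ-inverseˡ
                      , λ p → ≃-trans (+ᶠ-comm p (-ᶠ p)) (+ᶠ-inverseˡ p)
            ; ⁻¹-cong = -ᶠ-cong
            }
          ; comm = +ᶠ-comm
          }
        ; *-cong     = *ᶠ-cong
        ; *-assoc    = *ᶠ-assoc
        ; *-identity = *ᶠ-identityˡ
                     , λ p → ≃-trans (*ᶠ-comm p (embed 1#)) (*ᶠ-identityˡ p)
        ; distrib    = *ᶠ-distribˡ , *ᶠ-distribʳ
        }
      ; *-comm = *ᶠ-comm
      }
    }

ℤ[x] ℤ[x,y] ℤ[x,y,a] ℤ[x,y,a,b] : CommutativeRing 0ℓ 0ℓ
ℤ[x]       = Polynomial.polynomialRing ℤ.+-*-commutativeRing
ℤ[x,y]     = Polynomial.polynomialRing ℤ[x]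
ℤ[x,y,a]   = Polynomial.polynomialRing ℤ[x,y]
ℤ[x,y,a,b] = Polynomial.polynomialRing ℤ[x,y,a]

ℤ⟨x,y,a,b⟩ : CommutativeRing 0ℓ 0ℓ
ℤ⟨x,y,a,b⟩ = TotalFractions.fractionRing ℤ[x,y,a,b]

module Poly where
  open CommutativeRing ℤ[x,y,a,b] public
  open Exp semiring public using (_^_)

  𝕩 𝕪 𝕒 𝕓 : Carrier
  𝕩 = Polynomial.constant ℤ[x,y,a] (Polynomial.constant ℤ[x,y]
        (Polynomial.constant ℤ[x] (Polynomial.X ℤ.+-*-commutativeRing)))
  𝕪 = Polynomial.constant ℤ[x,y,a] (Polynomial.constant ℤ[x,y] (Polynomial.X ℤ[x]))
  𝕒 = Polynomial.constant ℤ[x,y,a] (Polynomial.X ℤ[x,y])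
  𝕓 = Polynomial.X ℤ[x,y,a]

module Frac where
  open CommutativeRing ℤ⟨x,y,a,b⟩ public
  open Exp semiring public using (_^_)
  open TotalFractions ℤ[x,y,a,b] public using (embed; Regular; _/_[_])

𝕒-regular : Frac.Regular Poly.𝕒
𝕒-regular = Polynomial.constant-cancel ℤ[x,y,a] (Polynomial.X ℤ[x,y]) (Polynomial.X-cancel ℤ[x,y])

𝕓-regular : Frac.Regular Poly.𝕓
𝕓-regular = Polynomial.X-cancel ℤ[x,y,a]

private
  ⁅⁆⊆ : ∀ {e : Fin n} {E} → e ∈ E → ⁅ e ⁆ ⊆ E
  ⁅⁆⊆ {e = e} {E} e∈E x∈⁅e⁆ = ≡.subst (_∈ E) (≡.sym (x∈⁅y⁆⇒x≡y e x∈⁅e⁆)) e∈E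

  ∪⊆ : ∀ {A B E : Subset n} → A ⊆ E → B ⊆ E → A ∪ B ⊆ E
  ∪⊆ {A = A} {B} A⊆E B⊆E = λ x∈A∪B → [ A⊆E , B⊆E ]′ (x∈p∪q⁻ A B x∈A∪B)

  ∩⊆ : ∀ {A B E : Subset n} → A ⊆ E → A ∩ B ⊆ E
  ∩⊆ {A = A} {B} A⊆E = λ x∈A∩B → A⊆E (p∩q⊆p A B x∈A∩B)

  ⊆─⇒⊆ : ∀ {X E : Subset n} A → X ⊆ E ─ A → X ⊆ E
  ⊆─⇒⊆ {E = E} A X⊆ = λ x∈X → p─q⊆p E A (X⊆ x∈X)

-- A ground set is a subset of Fin n, for an arbitrary n that minors inherit, so
-- that the elements of a minor are elements of the original polymatroid.

record Polymatroid (n : ℕ) : Set where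
  field
    E             : Subset n
    r             : (A : Subset n) → .(A ⊆ E) → ℤ
    r-empty       : r ⊥ ⊥⊆ ≡ + 0
    r-monotone    : ∀ A B (A⊆E : A ⊆ E) (B⊆E : B ⊆ E) → A ⊆ B → r A A⊆E ℤ.≤ r B B⊆E
    r-submodular  : ∀ A B (A⊆E : A ⊆ E) (B⊆E : B ⊆ E) →
                    r (A ∪ B) (∪⊆ A⊆E B⊆E) ℤ.+ r (A ∩ B) (∩⊆ A⊆E)
                      ℤ.≤ r A A⊆E ℤ.+ r B B⊆E

  rank : ℤ
  rank = r E ⊆-refl

  rᵉ : (e : Fin n) → .(e ∈ E) → ℤ
  rᵉ e e∈E = r ⁅ e ⁆ (⁅⁆⊆ e∈E)

open Polymatroid public

infix 4 _≈ᴾ_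

record _≈ᴾ_ (P Q : Polymatroid n) : Set where
  field
    E≡ : E P ≡ E Q
    r≡ : ∀ A .(A⊆P : A ⊆ E P) .(A⊆Q : A ⊆ E Q) → r P A A⊆P ≡ r Q A A⊆Q

open _≈ᴾ_ public

polymatroidSetoid : ℕ → Setoid 0ℓ 0ℓ
polymatroidSetoid n = record
  { Carrier       = Polymatroid n
  ; _≈_           = _≈ᴾ_
  ; isEquivalence = record
    { refl  = record { E≡ = ≡.refl ; r≡ = λ A p q → ≡.refl }
    ; sym   = λ P≈Q → record
      { E≡ = ≡.sym (E≡ P≈Q)
      ; r≡ = λ A p q → ≡.sym (r≡ P≈Q A q p)
      }
    ; trans = λ {P} {Q} {S} P≈Q Q≈S → record
      { E≡ = ≡.trans (E≡ P≈Q) (E≡ Q≈S)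
      ; r≡ = λ A p q → ≡.trans
          (r≡ P≈Q A p (≡.subst (A ⊆_) (E≡ P≈Q) p))
          (r≡ Q≈S A (≡.subst (A ⊆_) (E≡ P≈Q) p) q)
      }
    }
  }

infixl 6 _∖_

_∖_ : Polymatroid n → Subset n → Polymatroid n
P ∖ A = record
  { E            = E P ─ A
  ; r            = λ X X⊆ → r P X (⊆─⇒⊆ A X⊆)
  ; r-empty      = r-empty P
  ; r-monotone   = λ X Y X⊆ Y⊆ → r-monotone P X Y (⊆─⇒⊆ A X⊆) (⊆─⇒⊆ A Y⊆)
  ; r-submodular = λ X Y X⊆ Y⊆ → r-submodular P X Y (⊆─⇒⊆ A X⊆) (⊆─⇒⊆ A Y⊆)
  }

private
  r-cong : ∀ (P : Polymatroid n) {A B} → A ≡ B → .(p : A ⊆ E P) .(q : B ⊆ E P) →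
           r P A p ≡ r P B q
  r-cong P ≡.refl p q = ≡.refl

  ∪A⊆ : ∀ {X A E : Subset n} → A ⊆ E → X ⊆ E ─ A → X ∪ A ⊆ E
  ∪A⊆ {A = A} A⊆E X⊆ = ∪⊆ (⊆─⇒⊆ A X⊆) A⊆E

  ∪-monoˡ-⊆ : ∀ {X Y : Subset n} A → X ⊆ Y → X ∪ A ⊆ Y ∪ A
  ∪-monoˡ-⊆ {Y = Y} A X⊆Y =
    ∪⊆ (λ x∈X → p⊆p∪q A (X⊆Y x∈X)) (q⊆p∪q Y A)

  ∪-∪ : ∀ (X Y A : Subset n) → (X ∪ A) ∪ (Y ∪ A) ≡ (X ∪ Y) ∪ A
  ∪-∪ X Y A = begin
    (X ∪ A) ∪ (Y ∪ A)  ≡⟨ ∪-assoc X A (Y ∪ A) ⟩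
    X ∪ (A ∪ (Y ∪ A))  ≡⟨ ≡.cong (X ∪_) (∪-comm A (Y ∪ A)) ⟩
    X ∪ ((Y ∪ A) ∪ A)  ≡⟨ ≡.cong (X ∪_) (∪-assoc Y A A) ⟩
    X ∪ (Y ∪ (A ∪ A))  ≡⟨ ≡.cong (λ B → X ∪ (Y ∪ B)) (∪-idem A) ⟩
    X ∪ (Y ∪ A)        ≡⟨ ∪-assoc X Y A ⟨
    (X ∪ Y) ∪ A        ∎
    where open ≡.≡-Reasoning

  minus-both : ∀ s t u v w → s ℤ.+ t ℤ.≤ u ℤ.+ v →
               (s ℤ.- w) ℤ.+ (t ℤ.- w) ℤ.≤ (u ℤ.- w) ℤ.+ (v ℤ.- w)
  minus-both s t u v w le = ≡.subst₂ ℤ._≤_ (lemma s t w) (lemma u v w)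
    (ℤ.+-monoˡ-≤ (ℤ.- w ℤ.- w) le)
    where
    lemma : ∀ s t w → s ℤ.+ t ℤ.+ (ℤ.- w ℤ.- w) ≡ (s ℤ.- w) ℤ.+ (t ℤ.- w)
    lemma = solve-∀

infixl 6 _/_by_

_/_by_ : (P : Polymatroid n) (A : Subset n) → A ⊆ E P → Polymatroid n
P / A by A⊆E = record
  { E            = E P ─ A
  ; r            = λ X X⊆ → r P (X ∪ A) (∪A⊆ A⊆E X⊆) ℤ.- r P A A⊆E
  ; r-empty      = ≡.trans
      (≡.cong (ℤ._- r P A A⊆E) (r-cong P (∪-identityˡ A) _ _))
      (ℤ.+-inverseʳ (r P A A⊆E))
  ; r-monotone   = λ X Y X⊆ Y⊆ X⊆Y → ℤ.+-monoˡ-≤ (ℤ.- r P A A⊆E)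
      (r-monotone P (X ∪ A) (Y ∪ A) (∪A⊆ A⊆E X⊆) (∪A⊆ A⊆E Y⊆) (∪-monoˡ-⊆ A X⊆Y))
  ; r-submodular = λ X Y X⊆ Y⊆ →
      let X∪A⊆E = ∪A⊆ A⊆E X⊆
          Y∪A⊆E = ∪A⊆ A⊆E Y⊆
      in minus-both
        (r P ((X ∪ Y) ∪ A) (∪A⊆ A⊆E (∪⊆ X⊆ Y⊆))) (r P (X ∩ Y ∪ A) (∪A⊆ A⊆E (∩⊆ X⊆)))
        (r P (X ∪ A) X∪A⊆E) (r P (Y ∪ A) Y∪A⊆E) (r P A A⊆E)
        (≡.subst₂ (λ s t → s ℤ.+ t ℤ.≤ r P (X ∪ A) X∪A⊆E ℤ.+ r P (Y ∪ A) Y∪A⊆E)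
          (r-cong P (∪-∪ X Y A) _ _)
          (r-cong P (≡.sym (∪-distribʳ-∩ A X Y)) _ _)
          (r-submodular P (X ∪ A) (Y ∪ A) X∪A⊆E Y∪A⊆E))
  }

infixl 6 _∖ᵉ_ _/ᵉ_by_

_∖ᵉ_ : Polymatroid n → Fin n → Polymatroid n
P ∖ᵉ e = P ∖ ⁅ e ⁆

_/ᵉ_by_ : (P : Polymatroid n) (e : Fin n) → e ∈ E P → Polymatroid n
P /ᵉ e by e∈E = P / ⁅ e ⁆ by ⁅⁆⊆ e∈E

record _IsMinorOf_ (Q P : Polymatroid n) : Set where
  field
    A B      : Subset n
    A⊆E      : A ⊆ E P
    B⊆E      : B ⊆ E P
    disjoint : Empty (A ∩ B)
    minor    : Q ≈ᴾ (P / A by A⊆E) ∖ B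

Class : (ℓ : Level) → Set (lsuc ℓ)
Class ℓ = ∀ {n} → Pred (Polymatroid n) ℓ

IsKPolymatroid : ℕ → Polymatroid n → Set
IsKPolymatroid k P = ∀ e (e∈E : e ∈ E P) → rᵉ P e e∈E ℤ.≤ + k

-- _IsMinorOf_ is stated up to _≈ᴾ_, so a minor-closed class respects _≈ᴾ_.
MinorClosed : Class ℓ → Set ℓ
MinorClosed 𝒫 = ∀ {n} {P Q : Polymatroid n} → Q IsMinorOf P → 𝒫 P → 𝒫 Q

∖ᵉ-isMinor : (P : Polymatroid n) (e : Fin n) → e ∈ E P → (P ∖ᵉ e) IsMinorOf P
∖ᵉ-isMinor P e e∈E = record
  { A        = ⊥
  ; B        = ⁅ e ⁆
  ; A⊆E      = ⊥⊆
  ; B⊆E      = ⁅⁆⊆ e∈E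
  ; disjoint = λ (x , x∈) → ∉⊥ (p∩q⊆p ⊥ ⁅ e ⁆ x∈)
  ; minor    = record
    { E≡ = ≡.cong (_─ ⁅ e ⁆) (≡.sym (p─⊥≡p (E P)))
    ; r≡ = λ X p q → ≡.sym (≡.trans
        (≡.cong₂ ℤ._-_ (r-cong P (∪-identityʳ X) _ _) (r-empty P))
        (ℤ.+-identityʳ _))
    }
  }

/ᵉ-isMinor : (P : Polymatroid n) (e : Fin n) (e∈E : e ∈ E P) → (P /ᵉ e by e∈E) IsMinorOf P
/ᵉ-isMinor P e e∈E = record
  { A        = ⁅ e ⁆
  ; B        = ⊥
  ; A⊆E      = ⁅⁆⊆ e∈E
  ; B⊆E      = ⊥⊆
  ; disjoint = λ (x , x∈) → ∉⊥ (p∩q⊆q ⁅ e ⁆ ⊥ x∈)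
  ; minor    = record
    { E≡ = ≡.sym (p─⊥≡p _)
    ; r≡ = λ X p q → ≡.refl
    }
  }

module _ (R : CommutativeRing c ℓ) where
  open CommutativeRing R
  open Exp semiring using (_^_)

  -- ∑⊆ E f is the sum of f A over all A ⊆ E.
  ∑⊆ : (E : Subset n) → ((A : Subset n) → .(A ⊆ E) → Carrier) → Carrier
  ∑⊆ []            f = f [] ⊆-refl
  ∑⊆ (outside ∷ E) f = ∑⊆ E (λ A A⊆E → f (outside ∷ A) (out⊆ A⊆E))
  ∑⊆ (inside  ∷ E) f = ∑⊆ E (λ A A⊆E → f (outside ∷ A) (out⊆ A⊆E))
                     + ∑⊆ E (λ A A⊆E → f (inside  ∷ A) (in⊆in A⊆E))

  -- The value T_k(P; u, v) at elements u, v of R.  Both exponents are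
  -- nonnegative when P is a k-polymatroid, so ∣_∣ only converts ℤ to ℕ.
  Tutte : (k : ℕ) → Polymatroid n → (u v : Carrier) → Carrier
  Tutte k P u v = ∑⊆ (E P) λ A A⊆E →
    (u - 1#) ^ ∣ rank P ℤ.- r P A A⊆E ∣ *
    (v - 1#) ^ ∣ + (k ℕ.* card A) ℤ.- r P A A⊆E ∣

Δ : (P : Polymatroid n) → Fin n → ℤ
Δ P e = rank P ℤ.- rank (P ∖ᵉ e)

m : (k : ℕ) (P : Polymatroid n) (e : Fin n) → .(e ∈ E P) → ℤ
m k P e e∈E = + k ℤ.- rᵉ P e e∈E

module _ (𝒫 : Class ℓ) where

  Member : ℕ → Setoid ℓ 0ℓ
  Member n = On.setoid (polymatroidSetoid n) (proj₁ {B = 𝒫 {n}})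

  -- Congruence of Func says that the value at P depends only on the ground set
  -- and the values of the rank function, not on the proof of membership in 𝒫.
  Invariant : Set ℓ
  Invariant = ∀ n → Func (Member n) Poly.setoid

  ⟦_⟧ : Invariant → ∀ {n} (P : Polymatroid n) → 𝒫 P → Poly.Carrier
  ⟦ U ⟧ P P∈𝒫 = U _ ⟨$⟩ (P , P∈𝒫)

  infix 4 _≗ᴵ_

  _≗ᴵ_ : Invariant → Invariant → Set ℓ
  U ≗ᴵ V = ∀ {n} (P : Polymatroid n) (P∈𝒫 : 𝒫 P) → ⟦ U ⟧ P P∈𝒫 Poly.≈ ⟦ V ⟧ P P∈𝒫

  -- When 𝒫 consists of k-polymatroids, 0 ≤ Δ(e) ≤ r(e) ≤ k and 0 ≤ m(e) ≤ k, so
  -- ∣_∣ only converts the exponents from ℤ to ℕ.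
  record IsUniversal (k : ℕ) (closed : MinorClosed 𝒫) (U : Invariant) : Set ℓ where
    open Poly
    field
      empty     : ∀ {n} (P : Polymatroid n) (P∈𝒫 : 𝒫 P) → Empty (E P) →
                  ⟦ U ⟧ P P∈𝒫 ≈ 1#
      recursion : ∀ {n} (P : Polymatroid n) (P∈𝒫 : 𝒫 P) (e : Fin n) (e∈E : e ∈ E P) →
                  ⟦ U ⟧ P P∈𝒫 ≈
                    𝕒 ^ ∣ + k ℤ.- Δ P e ∣ * 𝕩 ^ ∣ Δ P e ∣
                      * ⟦ U ⟧ (P ∖ᵉ e) (closed (∖ᵉ-isMinor P e e∈E) P∈𝒫)
                    + 𝕓 ^ ∣ + k ℤ.- m k P e e∈E ∣ * 𝕪 ^ ∣ m k P e e∈E ∣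
                      * ⟦ U ⟧ (P /ᵉ e by e∈E) (closed (/ᵉ-isMinor P e e∈E) P∈𝒫)

{-# OPTIONS --safe #-}
module Submission where

-- Write ν(A) = k|A| - r(A).  In a k-polymatroid both r and ν are nonnegative and
-- monotone, so
--   U(P) = Σ_{A ⊆ E} a^(ν(E) - ν(A)) x^(r(E) - r(A)) b^r(A) y^ν(A)
-- is a polynomial.  The terms with e ∉ A are a^(k - Δ(e)) x^Δ(e) times those of P∖e,
-- and the terms with e ∈ A are b^(k - m(e)) y^m(e) times those of P/e, which gives
-- the recursion; the recursion determines U by induction on |E|.  Multiplying T_k by
-- a^ν(E) b^r(E) turns the powers of x/b and y/a into the monomials above.

open import Algebra.Bundles using (CommutativeRing; Semiring)
open import Algebra.Morphism.Structures using (module SemiringMorphisms)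
import Algebra.Properties.CommutativeSemigroup as CommutativeSemigroupProperties
import Algebra.Properties.CommutativeSemiring.Exp as CommutativeExp
import Algebra.Properties.Semiring.Exp as Exp
import Algebra.Solver.Ring.NaturalCoefficients.Default as SemiringSolver
open import Data.Fin.Base using (zero; suc)
open import Data.Fin.Subset
  using (Subset; inside; outside; _∈_; _∉_; _⊆_; _∪_; _∩_; _─_; ⁅_⁆; ⊥; Empty; Nonempty)
  renaming (∣_∣ to card; _-_ to _⊝_)
open import Data.Fin.Subset.Properties
open import Data.Integer.Base as ℤ using (ℤ; +_; ∣_∣; _-_; 0ℤ)
import Data.Integer.Properties as ℤ
open import Data.Integer.Tactic.RingSolver using (solve-∀)
open import Data.Nat.Base as ℕ using (ℕ; zero; suc; _≤_; _*_)
open import Data.Nat.Induction using (<-wellFounded)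
import Data.Nat.Properties as ℕ
open import Data.Product using (∃!; _×_; _,_)
open import Data.Sum.Base using ([_,_]′)
open import Data.Vec.Base using ([]; _∷_; here; there)
open import Function.Base using (_∘_)
open import Induction.WellFounded using (Acc; acc)
open import Level using (Level; _⊔_)
open import Relation.Binary.PropositionalEquality as ≡ using (_≡_)
import Relation.Binary.Reasoning.Setoid as SetoidReasoning
open import Relation.Nullary using (Dec; yes; no; contradiction)
open import Defs

private
  variable
    c ℓ c′ ℓ′ : Level
    n k : ℕ

-- Removing and adjoining one element of a subset

x∈p─q⇒x∉q : ∀ (p q : Subset n) {x} → x ∈ p ─ q → x ∉ q
x∈p─q⇒x∉q (_ ∷ p) (_ ∷ q) (there x∈) (there x∈q) = x∈p─q⇒x∉q p q x∈ x∈q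

x∉p-x : ∀ (p : Subset n) x → x ∉ p ⊝ x
x∉p-x p x x∈ = x∈p─q⇒x∉q p ⁅ x ⁆ x∈ (x∈⁅x⁆ x)

x∈p⇒⁅x⁆⊆p : ∀ {p : Subset n} {x} → x ∈ p → ⁅ x ⁆ ⊆ p
x∈p⇒⁅x⁆⊆p {p = p} {x} x∈p y∈ = ≡.subst (_∈ p) (≡.sym (x∈⁅y⁆⇒x≡y x y∈)) x∈p

∣p∪⁅x⁆∣ : ∀ {p : Subset n} {x} → x ∉ p → card (p ∪ ⁅ x ⁆) ≡ suc (card p)
∣p∪⁅x⁆∣ {p = inside  ∷ p} {zero}  x∉p = contradiction here x∉p
∣p∪⁅x⁆∣ {p = outside ∷ p} {zero}  x∉p = ≡.cong (suc ∘ card) (∪-identityʳ p)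
∣p∪⁅x⁆∣ {p = inside  ∷ p} {suc x} x∉p = ≡.cong suc (∣p∪⁅x⁆∣ (x∉p ∘ there))
∣p∪⁅x⁆∣ {p = outside ∷ p} {suc x} x∉p = ∣p∪⁅x⁆∣ (x∉p ∘ there)

x∈p⇒p-x∪⁅x⁆≡p : ∀ {p : Subset n} {x} → x ∈ p → (p ⊝ x) ∪ ⁅ x ⁆ ≡ p
-- Past its head `⁅ zero ⁆` is `⊥`, so the tail to be simplified is `(p ─ ⊥) ∪ ⊥`.
x∈p⇒p-x∪⁅x⁆≡p {p = _ ∷ p} here =
  ≡.cong (inside ∷_) (≡.trans (∪-identityʳ (p ─ ⊥)) (p─⊥≡p p))
x∈p⇒p-x∪⁅x⁆≡p {p = inside  ∷ p} (there x∈p) = ≡.cong (inside ∷_)  (x∈p⇒p-x∪⁅x⁆≡p x∈p)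
x∈p⇒p-x∪⁅x⁆≡p {p = outside ∷ p} (there x∈p) = ≡.cong (outside ∷_) (x∈p⇒p-x∪⁅x⁆≡p x∈p)

x∈p⇒∣p∣≡1+∣p-x∣ : ∀ {p : Subset n} {x} → x ∈ p → card p ≡ suc (card (p ⊝ x))
x∈p⇒∣p∣≡1+∣p-x∣ {p = p} {x} x∈p =
  ≡.trans (≡.cong card (≡.sym (x∈p⇒p-x∪⁅x⁆≡p x∈p))) (∣p∪⁅x⁆∣ (x∉p-x p x))

p⊆q-x⇒p∪⁅x⁆⊆q : ∀ {p q : Subset n} {x} → x ∈ q → p ⊆ q ⊝ x → p ∪ ⁅ x ⁆ ⊆ q
p⊆q-x⇒p∪⁅x⁆⊆q {p = p} {q} {x} x∈q p⊆q-x = λ y∈ →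
  [ (λ y∈p → p─q⊆p q ⁅ x ⁆ (p⊆q-x y∈p))
  , x∈p⇒⁅x⁆⊆p x∈q
  ]′ (x∈p∪q⁻ p ⁅ x ⁆ y∈)

+k*suc : ∀ k {i j} → i ≡ suc j → + (k * i) ≡ + k ℤ.+ + (k * j)
+k*suc k {j = j} ≡.refl = ≡.cong +_ (ℕ.*-suc k j)

-- Subset sums

module _ (R : CommutativeRing c ℓ) where
  open CommutativeRing R hiding (zero; _-_) renaming (_*_ to _·_)
  open SetoidReasoning setoid
  open CommutativeSemigroupProperties +-commutativeSemigroup using (interchange)

  private
    ∑ = λ {n} → ∑⊆ R {n}

  ∑⊆-cong : ∀ {E : Subset n} {f g : ∀ A → .(A ⊆ E) → Carrier} →
            (∀ A (A⊆E : A ⊆ E) → f A A⊆E ≈ g A A⊆E) → ∑ E f ≈ ∑ E g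
  ∑⊆-cong {E = []}          f≈g = f≈g [] ⊆-refl
  ∑⊆-cong {E = outside ∷ E} f≈g = ∑⊆-cong (λ A A⊆E → f≈g (outside ∷ A) (out⊆ A⊆E))
  ∑⊆-cong {E = inside  ∷ E} f≈g = +-cong
    (∑⊆-cong (λ A A⊆E → f≈g (outside ∷ A) (out⊆ A⊆E)))
    (∑⊆-cong (λ A A⊆E → f≈g (inside  ∷ A) (in⊆in A⊆E)))

  -- The types of `f` and `g` depend on the ground set. Handing the hypothesis both inclusion proofs
  -- avoids transporting either function along `E ≡ F`.
  ∑⊆-cong₂ : ∀ {E F : Subset n} {f : ∀ A → .(A ⊆ E) → Carrier} {g : ∀ A → .(A ⊆ F) → Carrier} →
             E ≡ F → (∀ A .(A⊆E : A ⊆ E) .(A⊆F : A ⊆ F) → f A A⊆E ≈ g A A⊆F) → ∑ E f ≈ ∑ F g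
  ∑⊆-cong₂ ≡.refl f≈g = ∑⊆-cong (λ A A⊆E → f≈g A A⊆E A⊆E)

  ∑⊆-⊥ : ∀ (f : ∀ A → .(A ⊆ ⊥ {n}) → Carrier) → ∑ ⊥ f ≈ f ⊥ ⊆-refl
  ∑⊆-⊥ {n = zero}  f = refl
  ∑⊆-⊥ {n = suc n} f = ∑⊆-⊥ (λ A A⊆ → f (outside ∷ A) (out⊆ A⊆))

  ∑⊆-*ˡ : ∀ s (E : Subset n) (f : ∀ A → .(A ⊆ E) → Carrier) →
          s · ∑ E f ≈ ∑ E (λ A A⊆E → s · f A A⊆E)
  ∑⊆-*ˡ s []            f = refl
  ∑⊆-*ˡ s (outside ∷ E) f = ∑⊆-*ˡ s E _
  ∑⊆-*ˡ s (inside  ∷ E) f =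
    trans (distribˡ _ _ _) (+-cong (∑⊆-*ˡ s E _) (∑⊆-*ˡ s E _))

  -- A subset of `E` either avoids `e` or is `A ∪ ⁅ e ⁆` for a unique `A ⊆ E ⊝ e`. The two sums
  -- become the deletion and the contraction term.
  ∑⊆-split : ∀ {E : Subset n} {e} (e∈E : e ∈ E) (f : ∀ A → .(A ⊆ E) → Carrier) →
             ∑ E f ≈ ∑ (E ⊝ e) (λ A A⊆ → f A (λ x∈A → p─q⊆p E ⁅ e ⁆ (A⊆ x∈A)))
                   + ∑ (E ⊝ e) (λ A A⊆ → f (A ∪ ⁅ e ⁆) (p⊆q-x⇒p∪⁅x⁆⊆q e∈E A⊆))
  -- At the position of `e` the sum is already split by definition; what remains is to replace
  -- `E ─ ⊥` by `E` and `A ∪ ⊥` by `A`.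
  ∑⊆-split {E = inside ∷ E} here f = +-cong
    (∑⊆-cong₂ {f = λ A A⊆E → f (outside ∷ A) (out⊆ A⊆E)} (≡.sym (p─⊥≡p E)) (λ A _ _ → refl))
    (∑⊆-cong₂ (≡.sym (p─⊥≡p E)) (λ A _ _ →
      f-cong (≡.cong (inside ∷_) (≡.sym (∪-identityʳ A)))))
    where
    f-cong : ∀ {A B} → A ≡ B → .{p : A ⊆ inside ∷ E} .{q : B ⊆ inside ∷ E} → f A p ≈ f B q
    f-cong ≡.refl = refl
  ∑⊆-split {E = outside ∷ E} (there e∈E) f = ∑⊆-split e∈E _
  ∑⊆-split {E = inside  ∷ E} (there e∈E) f =
    -- Each half splits at `e`; the four sums are regrouped by whether they contain `e` instead of
    -- the head.
    trans (+-cong (∑⊆-split e∈E _) (∑⊆-split e∈E _)) (interchange _ _ _ _)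

-- Rank and nullity

-- For `k` = 1 and a matroid this is the usual nullity; in general it is the exponent of `v - 1#` in
-- `Tutte`, before `∣_∣`.
nullity : ℕ → (P : Polymatroid n) (A : Subset n) → .(A ⊆ E P) → ℤ
nullity k P A A⊆E = + (k * card A) - r P A A⊆E

r-cong : ∀ (P : Polymatroid n) {A B} → A ≡ B → .{p : A ⊆ E P} .{q : B ⊆ E P} →
         r P A p ≡ r P B q
r-cong P ≡.refl = ≡.refl

nullity-cong : ∀ k (P : Polymatroid n) {A B} → A ≡ B → .{p : A ⊆ E P} .{q : B ⊆ E P} →
               nullity k P A p ≡ nullity k P B q
nullity-cong k P ≡.refl = ≡.refl

r-nonneg : ∀ (P : Polymatroid n) A (A⊆E : A ⊆ E P) → 0ℤ ℤ.≤ r P A A⊆E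
r-nonneg P A A⊆E =
  ≡.subst (ℤ._≤ r P A A⊆E) (r-empty P) (r-monotone P ⊥ A ⊥⊆ A⊆E ⊥⊆)

nullity-empty : ∀ k (P : Polymatroid n) → nullity k P ⊥ ⊥⊆ ≡ 0ℤ
nullity-empty {n} k P = ≡.cong₂ _-_
  (≡.cong +_ (≡.trans (≡.cong (k *_) (∣⊥∣≡0 n)) (ℕ.*-zeroʳ k))) (r-empty P)

module _ (P : Polymatroid n) where

  -- Submodularity with the nonnegative term r(A ∩ B) dropped.
  r-subadditive : ∀ A B (A⊆E : A ⊆ E P) (B⊆E : B ⊆ E P) (A∪B⊆E : A ∪ B ⊆ E P) →
                  r P (A ∪ B) A∪B⊆E ℤ.≤ r P A A⊆E ℤ.+ r P B B⊆E
  r-subadditive A B A⊆E B⊆E A∪B⊆E = begin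
    r P (A ∪ B) _                       ≡⟨ ℤ.+-identityʳ _ ⟨
    r P (A ∪ B) _ ℤ.+ 0ℤ
      ≤⟨ ℤ.+-monoʳ-≤ (r P (A ∪ B) _) (r-nonneg P (A ∩ B) A∩B⊆E) ⟩
    r P (A ∪ B) _ ℤ.+ r P (A ∩ B) A∩B⊆E ≤⟨ r-submodular P A B A⊆E B⊆E ⟩
    r P A _ ℤ.+ r P B _                 ∎
    where
    open ℤ.≤-Reasoning
    A∩B⊆E : A ∩ B ⊆ E P
    A∩B⊆E = λ x∈ → A⊆E (p∩q⊆p A B x∈)

  module _ (isK : IsKPolymatroid k P) where

    -- Returning `e` to `B ⊝ e` raises k|B| by exactly k, and the rank by at most r(e) ≤ k.
    nullity-delete-≤ : ∀ B (B⊆E : B ⊆ E P) {e} (e∈B : e ∈ B) (B-e⊆E : B ⊝ e ⊆ E P) →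
                       nullity k P (B ⊝ e) B-e⊆E ℤ.≤ nullity k P B B⊆E
    nullity-delete-≤ B B⊆E {e} e∈B B-e⊆E = begin
      K′ - R′                          ≡⟨ shift (+ k) K′ R′ ⟩
      (+ k ℤ.+ K′) - (R′ ℤ.+ + k)      ≤⟨ ℤ.+-monoʳ-≤ (+ k ℤ.+ K′) (ℤ.neg-mono-≤ bound) ⟩
      (+ k ℤ.+ K′) - r P B B⊆E
        ≡⟨ ≡.cong (_- r P B B⊆E) (+k*suc k (x∈p⇒∣p∣≡1+∣p-x∣ e∈B)) ⟨
      + (k * card B) - r P B B⊆E       ∎
      where
      open ℤ.≤-Reasoning
      K′ = + (k * card (B ⊝ e))
      R′ = r P (B ⊝ e) B-e⊆E
      bound : r P B B⊆E ℤ.≤ R′ ℤ.+ + k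
      bound = begin
        r P B B⊆E                     ≡⟨ r-cong P (x∈p⇒p-x∪⁅x⁆≡p e∈B) ⟨
        r P ((B ⊝ e) ∪ ⁅ e ⁆) _
          ≤⟨ r-subadditive (B ⊝ e) ⁅ e ⁆ B-e⊆E (x∈p⇒⁅x⁆⊆p (B⊆E e∈B))
               (p⊆q-x⇒p∪⁅x⁆⊆q (B⊆E e∈B)
                 -- `B ⊝ e` lies in `E P` and avoids `e`, hence lies in `E P ⊝ e`.
                 (λ x∈ → x∈p∧x≢y⇒x∈p-y (B-e⊆E x∈) λ where ≡.refl → x∉p-x B e x∈)) ⟩
        R′ ℤ.+ r P ⁅ e ⁆ _            ≤⟨ ℤ.+-monoʳ-≤ R′ (isK e (B⊆E e∈B)) ⟩
        R′ ℤ.+ + k                    ∎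
      shift : ∀ κ K R → K - R ≡ (κ ℤ.+ K) - (R ℤ.+ κ)
      shift = solve-∀

    private
      -- The elements of `B ─ A` are removed from `B` one at a time, each removal being an instance
      -- of `nullity-delete-≤`, until `B` equals `A`.
      nullity-mono-acc : ∀ A B (A⊆E : A ⊆ E P) (B⊆E : B ⊆ E P) → A ⊆ B →
                         Acc ℕ._<_ (card B) → nullity k P A A⊆E ℤ.≤ nullity k P B B⊆E
      nullity-mono-acc A B A⊆E B⊆E A⊆B (acc rec) with nonempty? (B ─ A)
      ... | no B─A-empty = ℤ.≤-reflexive (nullity-cong k P (⊆-antisym A⊆B B⊆A))
        where
        B⊆A : B ⊆ A
        B⊆A {x} x∈B with x ∈? A
        ... | yes x∈A = x∈A
        ... | no  x∉A = contradiction (x , x∈p∧x∉q⇒x∈p─q x∈B x∉A) B─A-empty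
      ... | yes (e , e∈B─A) = ℤ.≤-trans
        (nullity-mono-acc A (B ⊝ e) A⊆E B-e⊆E A⊆B-e (rec (x∈p⇒∣p-x∣<∣p∣ e∈B)))
        (nullity-delete-≤ B B⊆E e∈B B-e⊆E)
        where
        e∈B = p─q⊆p B A e∈B─A
        B-e⊆E : B ⊝ e ⊆ E P
        B-e⊆E x∈ = B⊆E (p─q⊆p B ⁅ e ⁆ x∈)
        A⊆B-e : A ⊆ B ⊝ e
        A⊆B-e x∈A = x∈p∧x≢y⇒x∈p-y (A⊆B x∈A) λ where ≡.refl → x∈p─q⇒x∉q B A e∈B─A x∈A

    nullity-mono : ∀ A B (A⊆E : A ⊆ E P) (B⊆E : B ⊆ E P) → A ⊆ B →
                   nullity k P A A⊆E ℤ.≤ nullity k P B B⊆E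
    nullity-mono A B A⊆E B⊆E A⊆B = nullity-mono-acc A B A⊆E B⊆E A⊆B (<-wellFounded _)

    nullity-nonneg : ∀ A (A⊆E : A ⊆ E P) → 0ℤ ℤ.≤ nullity k P A A⊆E
    nullity-nonneg A A⊆E = ≡.subst (ℤ._≤ nullity k P A A⊆E) (nullity-empty k P)
      (nullity-mono ⊥ A ⊥⊆ A⊆E ⊥⊆)

-- The subset expansion

module _ (R : CommutativeRing c ℓ) where
  open CommutativeRing R hiding (zero; _-_) renaming (_*_ to _·_)
  open Exp semiring using (_^_; ^-homo-*; ^-congˡ)
  open CommutativeExp commutativeSemiring using (^-distrib-*)
  open SetoidReasoning setoid
  open SemiringSolver commutativeSemiring using (solve; _:=_; _:*_)

  -- `∣_∣` is additive only on summands of equal sign; the two bounds leave just the nonnegative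
  -- constructors, where this is the power law in ℕ. The separate equation lets any integer identity
  -- supply the splitting.
  ^-∣+∣ : ∀ z {i j l} → 0ℤ ℤ.≤ j → 0ℤ ℤ.≤ l → i ≡ j ℤ.+ l → z ^ ∣ i ∣ ≈ z ^ ∣ j ∣ · z ^ ∣ l ∣
  ^-∣+∣ z {j = + j} {+ l} _ _ ≡.refl = ^-homo-* z j l

  ^-∣≡∣ : ∀ z {i j} → i ≡ j → z ^ ∣ i ∣ ≈ z ^ ∣ j ∣
  ^-∣≡∣ z ≡.refl = refl

  module _ (x y a b : Carrier) where

    -- The powers are paired as in the coefficients of the recursion: deletion affects only the pair
    -- of `a` and `x`, contraction only that of `b` and `y`.
    monomial : ℕ → (P : Polymatroid n) (A : Subset n) → .(A ⊆ E P) → Carrier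
    monomial k P A A⊆E =
      a ^ ∣ nullity k P (E P) ⊆-refl - nullity k P A A⊆E ∣ · x ^ ∣ rank P - r P A A⊆E ∣
        · (b ^ ∣ r P A A⊆E ∣ · y ^ ∣ nullity k P A A⊆E ∣)

    expansion : ℕ → Polymatroid n → Carrier
    expansion k P = ∑⊆ R (E P) (monomial k P)

    private
      *-cong₄ : ∀ {s t u v s′ t′ u′ v′} → s ≈ s′ → t ≈ t′ → u ≈ u′ → v ≈ v′ →
                s · t · (u · v) ≈ s′ · t′ · (u′ · v′)
      *-cong₄ e f g h = *-cong (*-cong e f) (*-cong g h)

    expansion-cong : ∀ k {P Q : Polymatroid n} → P ≈ᴾ Q → expansion k P ≈ expansion k Q
    expansion-cong k {P} {Q} P≈Q = ∑⊆-cong₂ R (E≡ P≈Q) λ A A⊆P A⊆Q →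
      let r≡A = r≡ P≈Q A A⊆P A⊆Q
          ν≡A = ≡.cong (λ i → + (k * card A) - i) r≡A
          νE≡ = ≡.cong₂ _-_ (≡.cong (λ F → + (k * card F)) (E≡ P≈Q)) rank≡
      in *-cong₄ (^-∣≡∣ a (≡.cong₂ _-_ νE≡ ν≡A)) (^-∣≡∣ x (≡.cong₂ _-_ rank≡ r≡A))
                 (^-∣≡∣ b r≡A) (^-∣≡∣ y ν≡A)
      where
      E⊆ : E P ⊆ E Q
      E⊆ = ≡.subst (E P ⊆_) (E≡ P≈Q) ⊆-refl
      rank≡ : rank P ≡ rank Q
      rank≡ = ≡.trans (r≡ P≈Q (E P) ⊆-refl E⊆) (r-cong Q (E≡ P≈Q))

    expansion-empty : ∀ k (P : Polymatroid n) → Empty (E P) → expansion k P ≈ 1#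
    expansion-empty k P E-empty = begin
      -- `E P` equals `⊥` only propositionally, so the summand is first restated over subsets of
      -- `⊥`.
      expansion k P          ≈⟨ ∑⊆-cong₂ R {g = λ A A⊆⊥ → monomial k P A (⊆-trans A⊆⊥ ⊥⊆)}
                                 (Empty-unique E-empty) (λ A _ _ → refl) ⟩
      ∑⊆ R ⊥ (λ A A⊆⊥ → monomial k P A (⊆-trans A⊆⊥ ⊥⊆))
                             ≈⟨ ∑⊆-⊥ R (λ A A⊆⊥ → monomial k P A (⊆-trans A⊆⊥ ⊥⊆)) ⟩
      monomial k P ⊥ ⊥⊆      ≈⟨ *-cong₄ (^-∣≡∣ a νE-ν⊥≡0) (^-∣≡∣ x rE-r⊥≡0)
                                  (^-∣≡∣ b (r-empty P)) (^-∣≡∣ y (nullity-empty k P)) ⟩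
      1# · 1# · (1# · 1#)    ≈⟨ trans (*-congʳ (*-identityˡ 1#)) (*-identityˡ (1# · 1#)) ⟩
      1# · 1#                ≈⟨ *-identityˡ 1# ⟩
      1#                     ∎
      where
      E≡⊥ = Empty-unique E-empty
      νE-ν⊥≡0 : nullity k P (E P) ⊆-refl - nullity k P ⊥ ⊥⊆ ≡ 0ℤ
      νE-ν⊥≡0 = ℤ.i≡j⇒i-j≡0 (nullity-cong k P E≡⊥)
      rE-r⊥≡0 : rank P - r P ⊥ ⊥⊆ ≡ 0ℤ
      rE-r⊥≡0 = ℤ.i≡j⇒i-j≡0 (r-cong P E≡⊥)

    module _ (P : Polymatroid n) {e} (e∈E : e ∈ E P) where
      private
        E-e⊆E : E P ⊝ e ⊆ E P
        E-e⊆E = p─q⊆p (E P) ⁅ e ⁆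

        E≡+ : ∀ k → + (k * card (E P)) ≡ + k ℤ.+ + (k * card (E P ⊝ e))
        E≡+ k = +k*suc k (x∈p⇒∣p∣≡1+∣p-x∣ e∈E)

      -- Since e ∉ A, r(A) and ν(A) are the same in both polymatroids, while r(E) drops by Δ(e) and
      -- ν(E) by k - Δ(e).
      monomial-∖ᵉ : IsKPolymatroid k P → ∀ A (A⊆ : A ⊆ E P ⊝ e) (A⊆E : A ⊆ E P) →
                    monomial k P A A⊆E
                      ≈ a ^ ∣ + k - Δ P e ∣ · x ^ ∣ Δ P e ∣ · monomial k (P ∖ᵉ e) A A⊆
      monomial-∖ᵉ {k = k} isK A A⊆ A⊆E = begin
        monomial k P A A⊆E
          ≈⟨ *-cong₄ (^-∣+∣ a 0≤k-Δ (ℤ.i≤j⇒0≤j-i (nullity-mono P isK A _ A⊆E E-e⊆E A⊆))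
                            a-exponent)
                     (^-∣+∣ x 0≤Δ (ℤ.i≤j⇒0≤j-i (r-monotone P A _ A⊆E E-e⊆E A⊆))
                            (x-exponent (rank P) (rank (P ∖ᵉ e)) (r P A A⊆E)))
                     refl refl ⟩
        _ ≈⟨ solve 6 (λ a₁ a₂ x₁ x₂ b₁ y₁ →
                a₁ :* a₂ :* (x₁ :* x₂) :* (b₁ :* y₁) := a₁ :* x₁ :* (a₂ :* x₂ :* (b₁ :* y₁)))
               refl _ _ _ _ _ _ ⟩
        a ^ ∣ + k - Δ P e ∣ · x ^ ∣ Δ P e ∣ · monomial k (P ∖ᵉ e) A A⊆ ∎
        where
        -- With K = k|E - e|, R = r(E) and R′ = r(E - e) this reads k - Δ(e) = ν(E) - ν(E - e),
        -- which is nonnegative because ν is monotone.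
        k-Δ≡ : ∀ κ K R R′ → κ - (R - R′) ≡ ((κ ℤ.+ K) - R) - (K - R′)
        k-Δ≡ = solve-∀
        0≤k-Δ : 0ℤ ℤ.≤ + k - Δ P e
        0≤k-Δ = ≡.subst (0ℤ ℤ.≤_)
          (≡.trans (≡.cong (λ i → (i - rank P) - nullity k P (E P ⊝ e) E-e⊆E) (E≡+ k))
                   (≡.sym (k-Δ≡ (+ k) (+ (k * card (E P ⊝ e))) (rank P) (rank (P ∖ᵉ e)))))
          (ℤ.i≤j⇒0≤j-i (nullity-mono P isK (E P ⊝ e) (E P) E-e⊆E ⊆-refl E-e⊆E))
        0≤Δ : 0ℤ ℤ.≤ Δ P e
        0≤Δ = ℤ.i≤j⇒0≤j-i (r-monotone P (E P ⊝ e) (E P) E-e⊆E ⊆-refl E-e⊆E)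
        a-shift : ∀ κ K R R′ ν → ((κ ℤ.+ K) - R) - ν ≡ (κ - (R - R′)) ℤ.+ ((K - R′) - ν)
        a-shift = solve-∀
        a-exponent : nullity k P (E P) ⊆-refl - nullity k P A A⊆E
          ≡ (+ k - Δ P e) ℤ.+ (nullity k P (E P ⊝ e) E-e⊆E - nullity k P A A⊆E)
        a-exponent = ≡.trans
          (≡.cong (λ i → (i - rank P) - nullity k P A A⊆E) (E≡+ k))
          (a-shift (+ k) (+ (k * card (E P ⊝ e))) (rank P) _ _)
        x-exponent : ∀ R R′ s → R - s ≡ (R - R′) ℤ.+ (R′ - s)
        x-exponent = solve-∀

      -- Passing from A ∪ e in P to A in P/e lowers the rank by r(e) = k - m(e) and ν by m(e),
      -- whatever A is. The differences in the exponents of `a` and `x` are thus unchanged. `isK/`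
      -- makes ν nonnegative in P/e, as splitting the power of `y` requires.
      monomial-/ᵉ : IsKPolymatroid k P → IsKPolymatroid k (P /ᵉ e by e∈E) →
                    ∀ A (A⊆ : A ⊆ E P ⊝ e) (A∪e⊆E : A ∪ ⁅ e ⁆ ⊆ E P) →
                    monomial k P (A ∪ ⁅ e ⁆) A∪e⊆E
                      ≈ b ^ ∣ + k - m k P e e∈E ∣ · y ^ ∣ m k P e e∈E ∣
                          · monomial k (P /ᵉ e by e∈E) A A⊆
      monomial-/ᵉ {k = k} isK isK/ A A⊆ A∪e⊆E = begin
        monomial k P (A ∪ ⁅ e ⁆) A∪e⊆E
          ≈⟨ *-cong₄ (^-∣≡∣ a a-exponent) (^-∣≡∣ x x-exponent)
                     (^-∣+∣ b 0≤k-m (r-nonneg P/e A A⊆)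
                            (b-exponent (+ k) (rᵉ P e e∈E) (r P (A ∪ ⁅ e ⁆) A∪e⊆E)))
                     (^-∣+∣ y 0≤m (nullity-nonneg P/e isK/ A A⊆) y-exponent) ⟩
        _ ≈⟨ solve 6 (λ a₁ x₁ b₁ b₂ y₁ y₂ →
                a₁ :* x₁ :* (b₁ :* b₂ :* (y₁ :* y₂)) := b₁ :* y₁ :* (a₁ :* x₁ :* (b₂ :* y₂)))
               refl _ _ _ _ _ _ ⟩
        b ^ ∣ + k - m k P e e∈E ∣ · y ^ ∣ m k P e e∈E ∣ · monomial k P/e A A⊆ ∎
        where
        P/e = P /ᵉ e by e∈E
        -- The rank of P/e unfolds to r((E - e) ∪ e) - r(e), whose union is `E P` only
        -- propositionally.
        rank≡ : rank P ≡ r P ((E P ⊝ e) ∪ ⁅ e ⁆) (p⊆q-x⇒p∪⁅x⁆⊆q e∈E ⊆-refl)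
        rank≡ = r-cong P (≡.sym (x∈p⇒p-x∪⁅x⁆≡p e∈E))
        A∪e≡+ : + (k * card (A ∪ ⁅ e ⁆)) ≡ + k ℤ.+ + (k * card A)
        A∪e≡+ = +k*suc k (∣p∪⁅x⁆∣ (x∉p-x (E P) e ∘ A⊆))
        x-shift : ∀ R s t → R - s ≡ (R - t) - (s - t)
        x-shift = solve-∀
        x-exponent : rank P - r P (A ∪ ⁅ e ⁆) A∪e⊆E ≡ rank P/e - r P/e A A⊆
        x-exponent = ≡.trans (x-shift (rank P) (r P (A ∪ ⁅ e ⁆) A∪e⊆E) (rᵉ P e e∈E))
          (≡.cong (λ i → (i - rᵉ P e e∈E) - r P/e A A⊆) rank≡)
        -- Here K = k|E - e|, L = k|A|, R = r(E), s = r(A ∪ e) and t = r(e); both κ and t cancel.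
        a-shift : ∀ κ K R L s t →
          ((κ ℤ.+ K) - R) - ((κ ℤ.+ L) - s) ≡ (K - (R - t)) - (L - (s - t))
        a-shift = solve-∀
        a-exponent : nullity k P (E P) ⊆-refl - nullity k P (A ∪ ⁅ e ⁆) A∪e⊆E
          ≡ nullity k P/e (E P ⊝ e) ⊆-refl - nullity k P/e A A⊆
        a-exponent = ≡.trans
          (≡.cong₂ (λ i j → (i - rank P) - (j - r P (A ∪ ⁅ e ⁆) A∪e⊆E)) (E≡+ k) A∪e≡+)
          (≡.trans (a-shift (+ k) (+ (k * card (E P ⊝ e))) (rank P)
                      (+ (k * card A)) (r P (A ∪ ⁅ e ⁆) A∪e⊆E) (rᵉ P e e∈E))
            (≡.cong (λ i → (+ (k * card (E P ⊝ e)) - (i - rᵉ P e e∈E)) - nullity k P/e A A⊆)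
                    rank≡))
        k-m≡ : ∀ κ t → κ - (κ - t) ≡ t
        k-m≡ = solve-∀
        0≤k-m : 0ℤ ℤ.≤ + k - m k P e e∈E
        0≤k-m = ≡.subst (0ℤ ℤ.≤_) (≡.sym (k-m≡ (+ k) (rᵉ P e e∈E))) 
          (r-nonneg P ⁅ e ⁆ (x∈p⇒⁅x⁆⊆p e∈E))
        b-exponent : ∀ κ t s → s ≡ (κ - (κ - t)) ℤ.+ (s - t)
        b-exponent = solve-∀
        0≤m : 0ℤ ℤ.≤ m k P e e∈E
        0≤m = ℤ.i≤j⇒0≤j-i (isK e e∈E)
        y-shift : ∀ κ L s t → (κ ℤ.+ L) - s ≡ (κ - t) ℤ.+ (L - (s - t))
        y-shift = solve-∀
        y-exponent : nullity k P (A ∪ ⁅ e ⁆) A∪e⊆E ≡ m k P e e∈E ℤ.+ nullity k P/e A A⊆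
        y-exponent = ≡.trans
          (≡.cong (_- r P (A ∪ ⁅ e ⁆) A∪e⊆E) A∪e≡+)
          (y-shift (+ k) (+ (k * card A)) (r P (A ∪ ⁅ e ⁆) A∪e⊆E) (rᵉ P e e∈E))

      -- Both minors have ground set `E P ⊝ e` by definition, so the halves given by `∑⊆-split` are
      -- compared term by term and the coefficient, free of A, is pulled out.
      expansion-recursion : IsKPolymatroid k P → IsKPolymatroid k (P /ᵉ e by e∈E) →
        expansion k P
          ≈ a ^ ∣ + k - Δ P e ∣ · x ^ ∣ Δ P e ∣ · expansion k (P ∖ᵉ e)
          + b ^ ∣ + k - m k P e e∈E ∣ · y ^ ∣ m k P e e∈E ∣ · expansion k (P /ᵉ e by e∈E)
      expansion-recursion {k = k} isK isK/ = trans (∑⊆-split R e∈E (monomial k P)) (+-cong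
        (trans (∑⊆-cong R (λ A A⊆ → monomial-∖ᵉ isK A A⊆ (⊆-trans A⊆ E-e⊆E)))
               (sym (∑⊆-*ˡ R _ (E P ⊝ e) (monomial k (P ∖ᵉ e)))))
        (trans (∑⊆-cong R (λ A A⊆ → monomial-/ᵉ isK isK/ A A⊆ (p⊆q-x⇒p∪⁅x⁆⊆q e∈E A⊆)))
               (sym (∑⊆-*ˡ R _ (E P ⊝ e) (monomial k (P /ᵉ e by e∈E))))))

    -- The two equations replace u = (x + b)/b and v = (y + a)/a, so the identity makes sense in
    -- every commutative ring. `u + - 1#` is the ring difference in `Tutte`, spelled out because
    -- `_-_` denotes integer subtraction here.
    Tutte-expansion : ∀ (P : Polymatroid n) → IsKPolymatroid k P → ∀ u v →
      b · (u + - 1#) ≈ x → a · (v + - 1#) ≈ y →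
      a ^ ∣ nullity k P (E P) ⊆-refl ∣ · b ^ ∣ rank P ∣ · Tutte R k P u v ≈ expansion k P
    Tutte-expansion {k = k} P isK u v bξ≈x aη≈y = trans
      (∑⊆-*ˡ R _ (E P) (λ A A⊆E → ξ ^ ∣ rank P - r P A A⊆E ∣ · η ^ ∣ nullity k P A A⊆E ∣))
      (∑⊆-cong R term)
      where
      ξ = u + - 1#
      η = v + - 1#
      +-shift : ∀ i j → i ≡ (i - j) ℤ.+ j
      +-shift = solve-∀
      -+-shift : ∀ i j → i ≡ j ℤ.+ (i - j)
      -+-shift = solve-∀
      term : ∀ A (A⊆E : A ⊆ E P) →
        a ^ ∣ nullity k P (E P) ⊆-refl ∣ · b ^ ∣ rank P ∣
          · (ξ ^ ∣ rank P - r P A A⊆E ∣ · η ^ ∣ nullity k P A A⊆E ∣)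
        ≈ monomial k P A A⊆E
      term A A⊆E = begin
        a ^ ∣ nullity k P (E P) ⊆-refl ∣ · b ^ ∣ rank P ∣ · (ξ ^ t · η ^ s)
          ≈⟨ *-congʳ (*-cong
               (^-∣+∣ a (ℤ.i≤j⇒0≤j-i (nullity-mono P isK A (E P) A⊆E ⊆-refl A⊆E))
                        (nullity-nonneg P isK A A⊆E)
                        (+-shift (nullity k P (E P) ⊆-refl) (nullity k P A A⊆E)))
               (^-∣+∣ b (r-nonneg P A A⊆E)
                        (ℤ.i≤j⇒0≤j-i (r-monotone P A (E P) A⊆E ⊆-refl A⊆E))
                        (-+-shift (rank P) (r P A A⊆E)))) ⟩
        -- The factor b^(r(E) - r(A)) meets the equal power of ξ and gives a power of `x`; a^ν(A)
        -- meets that of η and gives a power of `y`.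
        a ^ α · a ^ s · (b ^ ρ · b ^ t) · (ξ ^ t · η ^ s)
          ≈⟨ solve 6 (λ a₁ a₂ b₁ b₂ ξ₁ η₁ →
               a₁ :* a₂ :* (b₁ :* b₂) :* (ξ₁ :* η₁) := a₁ :* (b₂ :* ξ₁) :* (b₁ :* (a₂ :* η₁)))
              refl _ _ _ _ _ _ ⟩
        a ^ α · (b ^ t · ξ ^ t) · (b ^ ρ · (a ^ s · η ^ s))
          ≈⟨ *-cong₄ refl (power t bξ≈x) refl (power s aη≈y) ⟩
        monomial k P A A⊆E ∎
        where
        α = ∣ nullity k P (E P) ⊆-refl - nullity k P A A⊆E ∣
        ρ = ∣ r P A A⊆E ∣
        s = ∣ nullity k P A A⊆E ∣
        t = ∣ rank P - r P A A⊆E ∣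
        power : ∀ i {z w p} → z · w ≈ p → z ^ i · w ^ i ≈ p ^ i
        power i zw≈p = trans (sym (^-distrib-* _ _ i)) (^-congˡ i zw≈p)

-- Images of the expansion under semiring homomorphisms

module _ (R : CommutativeRing c ℓ) (S : CommutativeRing c′ ℓ′) where
  -- Semiring structure is what the expansion is built from: sums, products and powers, with
  -- subtraction only in the exponents.
  IsSemiringMap : (CommutativeRing.Carrier R → CommutativeRing.Carrier S) → Set (c ⊔ ℓ ⊔ ℓ′)
  IsSemiringMap = SemiringMorphisms.IsSemiringHomomorphism
    (Semiring.rawSemiring (CommutativeRing.semiring R))
    (Semiring.rawSemiring (CommutativeRing.semiring S))

  private
    module R = CommutativeRing R
    module S = CommutativeRing S
    module R^ = Exp R.semiring
    module S^ = Exp S.semiring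

  module _ {φ : R.Carrier → S.Carrier} (φ-hom : IsSemiringMap φ) where
    open SemiringMorphisms.IsSemiringHomomorphism φ-hom

    ^-homo : ∀ z i → φ (z R^.^ i) S.≈ φ z S^.^ i
    ^-homo z zero    = 1#-homo
    ^-homo z (suc i) = S.trans (*-homo z (z R^.^ i)) (S.*-congˡ (^-homo z i))

    ∑⊆-homo : ∀ (E : Subset n) (f : ∀ A → .(A ⊆ E) → R.Carrier) →
              φ (∑⊆ R E f) S.≈ ∑⊆ S E (λ A A⊆E → φ (f A A⊆E))
    ∑⊆-homo []            f = S.refl
    ∑⊆-homo (outside ∷ E) f = ∑⊆-homo E _
    ∑⊆-homo (inside  ∷ E) f =
      S.trans (+-homo _ _) (S.+-cong (∑⊆-homo E _) (∑⊆-homo E _))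

    expansion-homo : ∀ x y a b k (P : Polymatroid n) →
      φ (expansion R x y a b k P) S.≈ expansion S (φ x) (φ y) (φ a) (φ b) k P
    expansion-homo x y a b k P = S.trans (∑⊆-homo (E P) (monomial R x y a b k P))
      (∑⊆-cong S {g = monomial S (φ x) (φ y) (φ a) (φ b) k P} λ A A⊆E →
        *-homo₂
          (*-homo₂ (^-homo a ∣ nullity k P (E P) ⊆-refl - nullity k P A A⊆E ∣)
                   (^-homo x ∣ rank P - r P A A⊆E ∣))
          (*-homo₂ (^-homo b ∣ r P A A⊆E ∣) (^-homo y ∣ nullity k P A A⊆E ∣)))
      where
      *-homo₂ : ∀ {s t s′ t′} → φ s S.≈ s′ → φ t S.≈ t′ → φ (s R.* t) S.≈ s′ S.* t′
      *-homo₂ e f = S.trans (*-homo _ _) (S.*-cong e f)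

-- The embedding into the ring of fractions

module _ (R : CommutativeRing c ℓ) where
  open CommutativeRing R hiding (zero; _-_) renaming (_*_ to _·_)
  open TotalFractions R
  open SemiringSolver commutativeSemiring using (solve; _:=_; _:+_; _:*_; con)
  open SetoidReasoning setoid
  private module F = CommutativeRing fractionRing

  embed-isSemiringMap : IsSemiringMap R fractionRing embed
  embed-isSemiringMap = record
    { isNearSemiringHomomorphism = record
      { +-isMonoidHomomorphism = record
        { isMagmaHomomorphism = record
          { isRelHomomorphism = record { cong = λ e → cross (*-congʳ e) }
          ; homo = λ p q → cross (solve 2 (λ p q →
              (p :+ q) :* (con 1 :* con 1) := (p :* con 1 :+ q :* con 1) :* con 1) refl p q)
          }
        ; ε-homo = F.refl
        }
      ; *-homo = λ p q → cross (solve 2 (λ p q →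
          p :* q :* (con 1 :* con 1) := p :* q :* con 1) refl p q)
      }
    ; 1#-homo = F.refl
    }

  -- Provides the two equations assumed by `Tutte-expansion`, with `p` and `s` being x and b, or y
  -- and a.
  embed-*-fraction-minus-1 : ∀ p s (s-regular : Regular s) →
    embed s F.* (((p + s) / s [ s-regular ]) F.- F.1#) F.≈ embed p
  embed-*-fraction-minus-1 p s s-regular = cross (begin
    s · ((p + s) · 1# + - 1# · s) · 1#
      -- The semiring solver treats `- 1#` as an indeterminate t; the leftover multiple of 1 + t
      -- vanishes in the next step.
      ≈⟨ solve 3 (λ p s t → s :* ((p :+ s) :* con 1 :+ t :* s) :* con 1
           := p :* (con 1 :* (s :* con 1)) :+ s :* s :* (con 1 :+ t)) refl p s (- 1#) ⟩
    p · (1# · (s · 1#)) + s · s · (1# + - 1#)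
      ≈⟨ +-congˡ (trans (*-congˡ (-‿inverseʳ 1#)) (zeroʳ (s · s))) ⟩
    p · (1# · (s · 1#)) + 0#
      ≈⟨ +-identityʳ _ ⟩
    p · (1# · (s · 1#)) ∎)

module _ (R : CommutativeRing c ℓ) where
  open CommutativeRing R renaming (_*_ to _·_)

  -- The inductive step of uniqueness over an abstract ring, with `s` and `t` the coefficients of
  -- deletion and contraction.
  linear-cong : ∀ s t {p q p′ q′ u v} → u ≈ s · p + t · q → v ≈ s · p′ + t · q′ →
                p ≈ p′ → q ≈ q′ → u ≈ v
  linear-cong s t u≈ v≈ p≈p′ q≈q′ =
    trans u≈ (trans (+-cong (*-congˡ p≈p′) (*-congˡ q≈q′)) (sym v≈))

-- The universal invariant

polynomialExpansion : ℕ → Polymatroid n → Poly.Carrier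
polynomialExpansion = expansion ℤ[x,y,a,b] Poly.𝕩 Poly.𝕪 Poly.𝕒 Poly.𝕓

embed-polynomialExpansion : ∀ k (P : Polymatroid n) → IsKPolymatroid k P →
  Frac.embed (polynomialExpansion k P)
    Frac.≈
  Frac.embed Poly.𝕒 Frac.^ ∣ + (k * card (E P)) - rank P ∣
    Frac.* Frac.embed Poly.𝕓 Frac.^ ∣ rank P ∣
    Frac.* Tutte ℤ⟨x,y,a,b⟩ k P
             ((Poly.𝕩 Poly.+ Poly.𝕓) Frac./ Poly.𝕓 [ 𝕓-regular ])
             ((Poly.𝕪 Poly.+ Poly.𝕒) Frac./ Poly.𝕒 [ 𝕒-regular ])
embed-polynomialExpansion k P isK = begin
  Frac.embed (polynomialExpansion k P)
    ≈⟨ expansion-homo ℤ[x,y,a,b] ℤ⟨x,y,a,b⟩ (embed-isSemiringMap ℤ[x,y,a,b]) 𝕩 𝕪 𝕒 𝕓 k P ⟩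
  expansion ℤ⟨x,y,a,b⟩ (Frac.embed 𝕩) (Frac.embed 𝕪) (Frac.embed 𝕒) (Frac.embed 𝕓) k P
    ≈⟨ Tutte-expansion ℤ⟨x,y,a,b⟩
         (Frac.embed 𝕩) (Frac.embed 𝕪) (Frac.embed 𝕒) (Frac.embed 𝕓) P isK
         ((𝕩 Poly.+ 𝕓) Frac./ 𝕓 [ 𝕓-regular ]) ((𝕪 Poly.+ 𝕒) Frac./ 𝕒 [ 𝕒-regular ])
         (embed-*-fraction-minus-1 ℤ[x,y,a,b] 𝕩 𝕓 𝕓-regular)
         (embed-*-fraction-minus-1 ℤ[x,y,a,b] 𝕪 𝕒 𝕒-regular) ⟨
  Frac.embed 𝕒 Frac.^ ∣ + (k * card (E P)) - rank P ∣
    Frac.* Frac.embed 𝕓 Frac.^ ∣ rank P ∣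
    Frac.* Tutte ℤ⟨x,y,a,b⟩ k P
             ((𝕩 Poly.+ 𝕓) Frac./ 𝕓 [ 𝕓-regular ]) ((𝕪 Poly.+ 𝕒) Frac./ 𝕒 [ 𝕒-regular ]) ∎
  where
  open Poly using (𝕩; 𝕪; 𝕒; 𝕓)
  open SetoidReasoning Frac.setoid

module _ (k : ℕ) (𝒫 : Class ℓ)
         (isK : ∀ {n} (P : Polymatroid n) → 𝒫 P → IsKPolymatroid k P)
         (closed : MinorClosed 𝒫) where

  universal : Invariant 𝒫
  universal n = record
    { to   = λ (P , _) → polynomialExpansion k P
    ; cong = expansion-cong ℤ[x,y,a,b] Poly.𝕩 Poly.𝕪 Poly.𝕒 Poly.𝕓 k
    }

  universal-isUniversal : IsUniversal 𝒫 k closed universal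
  universal-isUniversal = record
    { empty     = λ P _ → expansion-empty ℤ[x,y,a,b] Poly.𝕩 Poly.𝕪 Poly.𝕒 Poly.𝕓 k P
    ; recursion = λ P P∈𝒫 e e∈E →
        expansion-recursion ℤ[x,y,a,b] Poly.𝕩 Poly.𝕪 Poly.𝕒 Poly.𝕓 P e∈E (isK P P∈𝒫)
          -- P/e is a k-polymatroid because it is a minor of P and so belongs to `𝒫`.
          (isK (P /ᵉ e by e∈E) (closed (/ᵉ-isMinor P e e∈E) P∈𝒫))
    }

-- Uniqueness by induction on the size of the ground set

module _ {k : ℕ} {𝒫 : Class ℓ} {closed : MinorClosed 𝒫} {U V : Invariant 𝒫}
         (U-universal : IsUniversal 𝒫 k closed U)
         (V-universal : IsUniversal 𝒫 k closed V) where
  open Poly using (_≈_; trans; sym; _^_; 𝕩; 𝕪; 𝕒; 𝕓)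
  private
    module U = IsUniversal U-universal
    module V = IsUniversal V-universal

  -- The case distinction is an argument because a with-abstraction would normalise
  -- the polynomials in the goal.
  universal-unique-acc : ∀ (P : Polymatroid n) (P∈𝒫 : 𝒫 P) → Acc ℕ._<_ (card (E P)) →
                         Dec (Nonempty (E P)) → ⟦_⟧ 𝒫 U P P∈𝒫 ≈ ⟦_⟧ 𝒫 V P P∈𝒫
  universal-unique-acc P P∈𝒫 _ (no E-empty) =
    trans (U.empty P P∈𝒫 E-empty) (sym (V.empty P P∈𝒫 E-empty))
  -- Both maps obey the recursion at every element, so any one `e` serves, provided it is the same
  -- for both.
  universal-unique-acc P P∈𝒫 (acc rec) (yes (e , e∈E)) = linear-cong ℤ[x,y,a,b]
    (𝕒 ^ ∣ + k - Δ P e ∣ Poly.* 𝕩 ^ ∣ Δ P e ∣)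
    (𝕓 ^ ∣ + k - m k P e e∈E ∣ Poly.* 𝕪 ^ ∣ m k P e e∈E ∣)
    (U.recursion P P∈𝒫 e e∈E) (V.recursion P P∈𝒫 e e∈E)
    (universal-unique-acc (P ∖ᵉ e) (closed (∖ᵉ-isMinor P e e∈E) P∈𝒫)
      (rec (x∈p⇒∣p-x∣<∣p∣ e∈E)) (nonempty? _))
    (universal-unique-acc (P /ᵉ e by e∈E) (closed (/ᵉ-isMinor P e e∈E) P∈𝒫)
      (rec (x∈p⇒∣p-x∣<∣p∣ e∈E)) (nonempty? _))

  universal-unique : _≗ᴵ_ 𝒫 U V
  universal-unique P P∈𝒫 = universal-unique-acc P P∈𝒫 (<-wellFounded _) (nonempty? _)

theorem3p7 : ∀ {ℓ} (k : ℕ) → 1 ≤ k →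
    (𝒫 : Class ℓ) →
    (∀ {n} (P : Polymatroid n) → 𝒫 P → IsKPolymatroid k P) →
    (closed : MinorClosed 𝒫) →
    ∃! (_≗ᴵ_ 𝒫) (IsUniversal 𝒫 k closed)
    ×
    (∀ (U : Invariant 𝒫) → IsUniversal 𝒫 k closed U →
    ∀ {n} (P : Polymatroid n) (P∈𝒫 : 𝒫 P) →
    Frac.embed (⟦_⟧ 𝒫 U P P∈𝒫)
    Frac.≈
    Frac.embed Poly.𝕒 Frac.^ ∣ + (k * card (E P)) - rank P ∣
    Frac.* Frac.embed Poly.𝕓 Frac.^ ∣ rank P ∣
    Frac.* Tutte ℤ⟨x,y,a,b⟩ k P
    ((Poly.𝕩 Poly.+ Poly.𝕓) Frac./ Poly.𝕓 [ 𝕓-regular ])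
    ((Poly.𝕪 Poly.+ Poly.𝕒) Frac./ Poly.𝕒 [ 𝕒-regular ]))
theorem3p7 k _ 𝒫 isK closed =
  (U₀ , U₀-universal ,
    λ {V} V-universal → universal-unique {U = U₀} {V} U₀-universal V-universal) ,
  -- By uniqueness `U` agrees with the expansion `U₀`, for which the formula has been shown.
  λ U U-universal P P∈𝒫 → Frac.trans
    {Frac.embed (⟦_⟧ 𝒫 U P P∈𝒫)} {Frac.embed (polynomialExpansion k P)}
    (⟦⟧-cong (universal-unique {U = U} {U₀} U-universal U₀-universal P P∈𝒫))
    (embed-polynomialExpansion k P (isK P P∈𝒫))
  where
  U₀ = universal k 𝒫 isK closed
  U₀-universal = universal-isUniversal k 𝒫 isK closed
  open SemiringMorphisms.IsSemiringHomomorphism (embed-isSemiringMap ℤ[x,y,a,b]) using (⟦⟧-cong)
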